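{- Let $k\ge 1$ be an integer and let $\mathcal{F}$ be a sunflower-free $k$-uniform set system (a family of $k$-element subsets of a finite set $\{1,\dots,n\}$). Let $M:=\left|\bigcup_{F\in\mathcal{F}}F\right|$. Then $$ |\mathcal{F}|\le 3\left(\left\lceil\frac{2k}{3}\right\rceil+1\right)\left(2^{1/3}\cdot 3e\right)^k\left(\left\lceil\frac Mk\right\rceil-1\right)^{\left\lceil\frac{2k}{3}\right\rceil}. $$
   Context: A family of sets is $k$-uniform if each of its members has exactly $k$ elements. Three distinct sets $F_1,F_2,F_3$ form a sunflower (with 3 petals) if $F_i\cap F_j=F_1\cap F_2\cap F_3$ for all $1\le i<j\le 3$ (pairwise disjoint sets form a sunflower with empty kernel). A family is sunflower-free if no three distinct members of it form a sunflower. $e$ is the base of the natural logarithm.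
   Formalization: The family is assumed to have at least two members: for a single k-set, M = k and the stated right side is 0 < 1, and for the empty family the factor ⌈M/k⌉−1 is −1, so the bound fails when ⌈2k/3⌉ is odd. -}

module Defs where

open import Data.Fin.Subset using (Subset; _∩_; ∣_∣)
open import Data.Integer.Base using (+_)
import Data.Integer.Base as ℤ
import Data.Integer.Properties as ℤₚ
open import Data.List.Base using (List)
open import Data.List.Membership.Propositional using (_∈_)
open import Data.List.Relation.Unary.All using (All)
open import Data.Nat.Base as ℕ using (ℕ; zero; suc; NonZero; _!; s≤s; z≤n)
import Data.Nat.DivMod as ℕ
import Data.Nat.Properties as ℕₚ
open import Data.Nat.Solver using (module +-*-Solver)
open import Data.Product.Base using (∃; _×_; _,_; proj₁; proj₂)
open import Data.Rational.Base as ℚ using (ℚ; mkℚ; 0ℚ; 1ℚ; ↧ₙ_; _/_; toℚᵘ)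
import Data.Rational.Properties as ℚₚ
import Data.Rational.Solver as ℚSolver
open import Data.Rational.Unnormalised.Base as ℚᵘ using (mkℚᵘ)
import Data.Rational.Unnormalised.Properties as ℚᵘₚ
open import Data.Sum.Base using (inj₁; inj₂)
open import Relation.Binary.PropositionalEquality
open import Relation.Nullary using (¬_; yes; no)

-- A family of subsets of an n-element ground set is represented by a list
-- without repetitions, so that its cardinality is the length of the list.

Uniform : ∀ {n} → ℕ → List (Subset n) → Set
Uniform k F = All (λ S → ∣ S ∣ ≡ k) F

IsSunflower : ∀ {n} → Subset n → Subset n → Subset n → Set
IsSunflower A B C = A ∩ B ≡ K × A ∩ C ≡ K × B ∩ C ≡ K
  where K = A ∩ B ∩ C

SunflowerFree : ∀ {n} → List (Subset n) → Set
SunflowerFree F = ∀ {A B C} → A ∈ F → B ∈ F → C ∈ F →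
                  A ≢ B → A ≢ C → B ≢ C → ¬ IsSunflower A B C

⌈_/_⌉ : (m n : ℕ) .{{_ : NonZero n}} → ℕ
⌈ m / n ⌉ = (m ℕ.+ ℕ.pred n) ℕ./ n

-- Reals are Cauchy sequences of rationals, compared through the setoid
-- equality _≃_; x ≤ y means that x n ≤ y n + ε eventually, for every ε > 0.

Cauchy : (ℕ → ℚ) → Set
Cauchy x = ∀ ε → 0ℚ ℚ.< ε → ∃ λ N → ∀ m n → N ℕ.≤ m → N ℕ.≤ n →
           ℚ.∣ x m ℚ.- x n ∣ ℚ.≤ ε

record ℝ : Set where
  constructor mkℝ
  field
    seq    : ℕ → ℚ
    cauchy : Cauchy seq

open ℝ public

infix 4 _≤_ _≃_

_≤_ : ℝ → ℝ → Set
x ≤ y = ∀ ε → 0ℚ ℚ.< ε → ∃ λ N → ∀ n → N ℕ.≤ n → seq x n ℚ.≤ seq y n ℚ.+ ε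

_≃_ : ℝ → ℝ → Set
x ≃ y = x ≤ y × y ≤ x

abs-diff : ∀ {a b ε} → a ℚ.≤ b ℚ.+ ε → b ℚ.≤ a ℚ.+ ε → ℚ.∣ a ℚ.- b ∣ ℚ.≤ ε
abs-diff {a} {b} {ε} p q with ℚₚ.∣p∣≡p∨∣p∣≡-p (a ℚ.- b)
... | inj₁ eq = subst (ℚ._≤ ε) (sym eq)
                  (subst (a ℚ.- b ℚ.≤_) (lem b ε) (ℚₚ.+-monoˡ-≤ (ℚ.- b) p))
  where
  open ℚSolver.+-*-Solver
  lem : ∀ b ε → b ℚ.+ ε ℚ.- b ≡ ε
  lem = solve 2 (λ b ε → b :+ ε :- b := ε) refl
... | inj₂ eq = subst (ℚ._≤ ε) (sym eq)
                  (subst₂ ℚ._≤_ (lem₁ a b) (lem₂ a ε) (ℚₚ.+-monoˡ-≤ (ℚ.- a) q))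
  where
  open ℚSolver.+-*-Solver
  lem₁ : ∀ a b → b ℚ.- a ≡ ℚ.- (a ℚ.- b)
  lem₁ = solve 2 (λ a b → b :- a := :- (a :- b)) refl
  lem₂ : ∀ a ε → a ℚ.+ ε ℚ.- a ≡ ε
  lem₂ = solve 2 (λ a ε → a :+ ε :- a := ε) refl

eventually-bounded : ∀ (x : ℝ) → ∃ λ B → 0ℚ ℚ.< B ×
                     ∃ λ N → ∀ n → N ℕ.≤ n → ℚ.∣ seq x n ∣ ℚ.≤ B
eventually-bounded x with cauchy x 1ℚ (ℚₚ.positive⁻¹ 1ℚ)
... | N , h = 1ℚ ℚ.+ ℚ.∣ xN ∣
            , ℚₚ.+-mono-<-≤ (ℚₚ.positive⁻¹ 1ℚ) (ℚₚ.0≤∣p∣ xN)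
            , N , bound
  where
  open ℚSolver.+-*-Solver
  xN = seq x N
  split : ∀ a b → a ℚ.- b ℚ.+ b ≡ a
  split = solve 2 (λ a b → a :- b :+ b := a) refl
  bound : ∀ n → N ℕ.≤ n → ℚ.∣ seq x n ∣ ℚ.≤ 1ℚ ℚ.+ ℚ.∣ xN ∣
  bound n N≤n = begin
    ℚ.∣ seq x n ∣                     ≡⟨ cong ℚ.∣_∣ (split (seq x n) xN) ⟨
    ℚ.∣ seq x n ℚ.- xN ℚ.+ xN ∣       ≤⟨ ℚₚ.∣p+q∣≤∣p∣+∣q∣ (seq x n ℚ.- xN) xN ⟩
    ℚ.∣ seq x n ℚ.- xN ∣ ℚ.+ ℚ.∣ xN ∣ ≤⟨ ℚₚ.+-monoˡ-≤ ℚ.∣ xN ∣ (h n N N≤n ℕₚ.≤-refl) ⟩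
    1ℚ ℚ.+ ℚ.∣ xN ∣                   ∎
    where open ℚₚ.≤-Reasoning

*-mono-≤ : ∀ {a b c d} → 0ℚ ℚ.≤ a → 0ℚ ℚ.≤ d → a ℚ.≤ b → c ℚ.≤ d → a ℚ.* c ℚ.≤ b ℚ.* d
*-mono-≤ {a} {b} {c} {d} 0≤a 0≤d a≤b c≤d = ℚₚ.≤-trans
  (ℚₚ.*-monoˡ-≤-nonNeg a {{ℚ.nonNegative 0≤a}} c≤d)
  (ℚₚ.*-monoʳ-≤-nonNeg d {{ℚ.nonNegative 0≤d}} a≤b)

*-cauchy : ∀ x y → Cauchy (λ n → seq x n ℚ.* seq y n)
*-cauchy x y ε ε>0 = M , bound
  where
  open ℚSolver.+-*-Solver
  bx = eventually-bounded x
  by = eventually-bounded y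
  B = proj₁ bx ℚ.+ proj₁ by
  B>0 : 0ℚ ℚ.< B
  B>0 = ℚₚ.+-mono-< (proj₁ (proj₂ bx)) (proj₁ (proj₂ by))
  instance
    posB : ℚ.Positive B
    posB = ℚ.positive B>0
    B≢0 : ℚ.NonZero B
    B≢0 = ℚₚ.pos⇒nonZero B
    posε : ℚ.Positive ε
    posε = ℚ.positive ε>0
  δ = ε ℚ.* ℚ.1/ B
  δ>0 : 0ℚ ℚ.< δ
  δ>0 = ℚₚ.positive⁻¹ δ {{ℚₚ.pos*pos⇒pos ε (ℚ.1/ B) {{ℚₚ.1/pos⇒pos B}}}}
  cx = cauchy x δ δ>0
  cy = cauchy y δ δ>0
  Nx = proj₁ (proj₂ (proj₂ bx)) ℕ.⊔ proj₁ cx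
  Ny = proj₁ (proj₂ (proj₂ by)) ℕ.⊔ proj₁ cy
  M = Nx ℕ.⊔ Ny
  split : ∀ a b c d → a ℚ.* c ℚ.- b ℚ.* d ≡ a ℚ.* (c ℚ.- d) ℚ.+ d ℚ.* (a ℚ.- b)
  split = solve 4 (λ a b c d → a :* c :- b :* d := a :* (c :- d) :+ d :* (a :- b)) refl
  collect : B ℚ.* δ ≡ ε
  collect = begin
    B ℚ.* (ε ℚ.* ℚ.1/ B) ≡⟨ lem B ε (ℚ.1/ B) ⟩
    ε ℚ.* (B ℚ.* ℚ.1/ B) ≡⟨ cong (ε ℚ.*_) (ℚₚ.*-inverseʳ B) ⟩
    ε ℚ.* 1ℚ             ≡⟨ ℚₚ.*-identityʳ ε ⟩
    ε                    ∎
    where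
    open ≡-Reasoning
    lem : ∀ a b c → a ℚ.* (b ℚ.* c) ≡ b ℚ.* (a ℚ.* c)
    lem = solve 3 (λ a b c → a :* (b :* c) := b :* (a :* c)) refl
  bound : ∀ m n → M ℕ.≤ m → M ℕ.≤ n →
          ℚ.∣ seq x m ℚ.* seq y m ℚ.- seq x n ℚ.* seq y n ∣ ℚ.≤ ε
  bound m n M≤m M≤n = begin
    ℚ.∣ a ℚ.* c ℚ.- b ℚ.* d ∣
      ≡⟨ cong ℚ.∣_∣ (split a b c d) ⟩
    ℚ.∣ a ℚ.* (c ℚ.- d) ℚ.+ d ℚ.* (a ℚ.- b) ∣
      ≤⟨ ℚₚ.∣p+q∣≤∣p∣+∣q∣ (a ℚ.* (c ℚ.- d)) (d ℚ.* (a ℚ.- b)) ⟩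
    ℚ.∣ a ℚ.* (c ℚ.- d) ∣ ℚ.+ ℚ.∣ d ℚ.* (a ℚ.- b) ∣
      ≡⟨ cong₂ ℚ._+_ (ℚₚ.∣p*q∣≡∣p∣*∣q∣ a (c ℚ.- d)) (ℚₚ.∣p*q∣≡∣p∣*∣q∣ d (a ℚ.- b)) ⟩
    ℚ.∣ a ∣ ℚ.* ℚ.∣ c ℚ.- d ∣ ℚ.+ ℚ.∣ d ∣ ℚ.* ℚ.∣ a ℚ.- b ∣
      ≤⟨ ℚₚ.+-mono-≤
           (*-mono-≤ (ℚₚ.0≤∣p∣ a) (ℚₚ.<⇒≤ δ>0)
             (proj₂ (proj₂ (proj₂ bx)) m (M≥bx m M≤m))
             (proj₂ cy m n (M≥cy m M≤m) (M≥cy n M≤n)))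
           (*-mono-≤ (ℚₚ.0≤∣p∣ d) (ℚₚ.<⇒≤ δ>0)
             (proj₂ (proj₂ (proj₂ by)) n (M≥by n M≤n))
             (proj₂ cx m n (M≥cx m M≤m) (M≥cx n M≤n))) ⟩
    proj₁ bx ℚ.* δ ℚ.+ proj₁ by ℚ.* δ
      ≡⟨ ℚₚ.*-distribʳ-+ δ (proj₁ bx) (proj₁ by) ⟨
    B ℚ.* δ
      ≡⟨ collect ⟩
    ε ∎
    where
    open ℚₚ.≤-Reasoning
    a = seq x m
    b = seq x n
    c = seq y m
    d = seq y n
    M≥Nx : ∀ i → M ℕ.≤ i → Nx ℕ.≤ i
    M≥Nx i = ℕₚ.m⊔n≤o⇒m≤o Nx Ny
    M≥Ny : ∀ i → M ℕ.≤ i → Ny ℕ.≤ i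
    M≥Ny i = ℕₚ.m⊔n≤o⇒n≤o Nx Ny
    M≥bx : ∀ i → M ℕ.≤ i → proj₁ (proj₂ (proj₂ bx)) ℕ.≤ i
    M≥bx i p = ℕₚ.m⊔n≤o⇒m≤o _ (proj₁ cx) (M≥Nx i p)
    M≥cx : ∀ i → M ℕ.≤ i → proj₁ cx ℕ.≤ i
    M≥cx i p = ℕₚ.m⊔n≤o⇒n≤o (proj₁ (proj₂ (proj₂ bx))) _ (M≥Nx i p)
    M≥by : ∀ i → M ℕ.≤ i → proj₁ (proj₂ (proj₂ by)) ℕ.≤ i
    M≥by i p = ℕₚ.m⊔n≤o⇒m≤o _ (proj₁ cy) (M≥Ny i p)
    M≥cy : ∀ i → M ℕ.≤ i → proj₁ cy ℕ.≤ i
    M≥cy i p = ℕₚ.m⊔n≤o⇒n≤o (proj₁ (proj₂ (proj₂ by))) _ (M≥Ny i p)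

infixl 7 _*_
infixr 8 _^_

fromℚ : ℚ → ℝ
fromℚ q = mkℝ (λ _ → q) λ ε ε>0 → 0 , λ _ _ _ _ →
  subst (ℚ._≤ ε) (sym (cong ℚ.∣_∣ (ℚₚ.+-inverseʳ q))) (ℚₚ.<⇒≤ ε>0)

fromℕ : ℕ → ℝ
fromℕ m = fromℚ (+ m / 1)

_*_ : ℝ → ℝ → ℝ
x * y = mkℝ (λ n → seq x n ℚ.* seq y n) (*-cauchy x y)

_^_ : ℝ → ℕ → ℝ
x ^ zero  = fromℕ 1
x ^ suc n = x * x ^ n

frac-≤ : ∀ a b c d .{{_ : NonZero b}} .{{_ : NonZero d}} →
         a ℕ.* d ℕ.≤ c ℕ.* b → + a / b ℚ.≤ + c / d
frac-≤ a (suc b) c (suc d) p = ℚₚ.toℚᵘ-cancel-≤ (begin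
  toℚᵘ (+ a / suc b) ≃⟨ ℚₚ.toℚᵘ-fromℚᵘ (mkℚᵘ (+ a) b) ⟩
  mkℚᵘ (+ a) b       ≤⟨ ℚᵘ.*≤* (subst₂ ℤ._≤_ (ℤₚ.pos-* a (suc d)) (ℤₚ.pos-* c (suc b)) (ℤ.+≤+ p)) ⟩
  mkℚᵘ (+ c) d       ≃⟨ ℚₚ.toℚᵘ-fromℚᵘ (mkℚᵘ (+ c) d) ⟨
  toℚᵘ (+ c / suc d) ∎)
  where open ℚᵘₚ.≤-Reasoning

frac-* : ∀ a b c d .{{_ : NonZero b}} .{{_ : NonZero d}} .{{_ : NonZero (b ℕ.* d)}} →
         (+ a / b) ℚ.* (+ c / d) ≡ + (a ℕ.* c) / (b ℕ.* d)
frac-* a (suc b) c (suc d) = ℚₚ.toℚᵘ-injective (begin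
  toℚᵘ ((+ a / suc b) ℚ.* (+ c / suc d))
    ≈⟨ ℚₚ.toℚᵘ-homo-* (+ a / suc b) (+ c / suc d) ⟩
  toℚᵘ (+ a / suc b) ℚᵘ.* toℚᵘ (+ c / suc d)
    ≈⟨ ℚᵘₚ.*-cong (ℚₚ.toℚᵘ-fromℚᵘ (mkℚᵘ (+ a) b)) (ℚₚ.toℚᵘ-fromℚᵘ (mkℚᵘ (+ c) d)) ⟩
  mkℚᵘ (+ a) b ℚᵘ.* mkℚᵘ (+ c) d
    ≈⟨ ℚᵘ.*≡* (cong (ℤ._* + (suc b ℕ.* suc d)) (sym (ℤₚ.pos-* a c))) ⟩
  mkℚᵘ (+ (a ℕ.* c)) (d ℕ.+ b ℕ.* suc d)
    ≈⟨ ℚₚ.toℚᵘ-fromℚᵘ (mkℚᵘ (+ (a ℕ.* c)) (d ℕ.+ b ℕ.* suc d)) ⟨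
  toℚᵘ (+ (a ℕ.* c) / (suc b ℕ.* suc d)) ∎)
  where open import Relation.Binary.Reasoning.Setoid ℚᵘₚ.≃-setoid

frac-+ : ∀ a b d .{{_ : NonZero d}} → + (a ℕ.+ b) / d ≡ (+ a / d) ℚ.+ (+ b / d)
frac-+ a b (suc d) = ℚₚ.toℚᵘ-injective (begin
  toℚᵘ (+ (a ℕ.+ b) / suc d)
    ≈⟨ ℚₚ.toℚᵘ-fromℚᵘ (mkℚᵘ (+ (a ℕ.+ b)) d) ⟩
  mkℚᵘ (+ (a ℕ.+ b)) d
    ≈⟨ ℚᵘ.*≡* (trans (cong (ℤ._* + (suc d ℕ.* suc d)) (ℤₚ.pos-+ a b))
                (trans (cong ((+ a ℤ.+ + b) ℤ.*_) (ℤₚ.pos-* (suc d) (suc d)))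
                  (trans (sym (ℤₚ.*-assoc (+ a ℤ.+ + b) (+ suc d) (+ suc d)))
                    (cong (ℤ._* + suc d) (ℤₚ.*-distribʳ-+ (+ suc d) (+ a) (+ b)))))) ⟩
  mkℚᵘ (+ a) d ℚᵘ.+ mkℚᵘ (+ b) d
    ≈⟨ ℚᵘₚ.+-cong (ℚₚ.toℚᵘ-fromℚᵘ (mkℚᵘ (+ a) d)) (ℚₚ.toℚᵘ-fromℚᵘ (mkℚᵘ (+ b) d)) ⟨
  toℚᵘ (+ a / suc d) ℚᵘ.+ toℚᵘ (+ b / suc d)
    ≈⟨ ℚₚ.toℚᵘ-homo-+ (+ a / suc d) (+ b / suc d) ⟨
  toℚᵘ ((+ a / suc d) ℚ.+ (+ b / suc d)) ∎)
  where open import Relation.Binary.Reasoning.Setoid ℚᵘₚ.≃-setoid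

frac-nonNeg : ∀ a b .{{_ : NonZero b}} → 0ℚ ℚ.≤ + a / b
frac-nonNeg a b = frac-≤ 0 1 a b z≤n

archimedean : ∀ ε → 0ℚ ℚ.< ε → ∀ n → ↧ₙ ε ℕ.≤ n → + 1 / suc n ℚ.≤ ε
archimedean ε@(mkℚ (+ suc p) q _) _ n q<n =
  subst (+ 1 / suc n ℚ.≤_) (ℚₚ.fromℚᵘ-toℚᵘ ε)
    (frac-≤ 1 (suc n) (suc p) (suc q)
      (subst (ℕ._≤ suc p ℕ.* suc n) (sym (ℕₚ.*-identityˡ (suc q)))
        (ℕₚ.≤-trans (ℕₚ.m≤n⇒m≤1+n q<n) (ℕₚ.m≤n*m (suc n) (suc p)))))
archimedean (mkℚ (+ 0) q _) (ℚ.*<* (ℤ.+<+ ()))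
archimedean (mkℚ (ℤ.-[1+ _ ]) q _) (ℚ.*<* ())

-- Nested intervals [l n, u n], the n-th of length at most 1/(n+1).
record Nested (l u : ℕ → ℚ) : Set where
  field
    l-inc : ∀ n → l n ℚ.≤ l (suc n)
    u-dec : ∀ n → u (suc n) ℚ.≤ u n
    l≤u   : ∀ n → l n ℚ.≤ u n
    gap   : ∀ n → u n ℚ.≤ l n ℚ.+ + 1 / suc n

  l-mono : ∀ {m n} → m ℕ.≤′ n → l m ℚ.≤ l n
  l-mono (ℕ.≤′-reflexive refl) = ℚₚ.≤-refl
  l-mono (ℕ.≤′-step p)         = ℚₚ.≤-trans (l-mono p) (l-inc _)

  u-anti : ∀ {m n} → m ℕ.≤′ n → u n ℚ.≤ u m
  u-anti (ℕ.≤′-reflexive refl) = ℚₚ.≤-refl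
  u-anti (ℕ.≤′-step p)         = ℚₚ.≤-trans (u-dec _) (u-anti p)

  l-cauchy : Cauchy l
  l-cauchy ε ε>0 = N , λ m n N≤m N≤n → abs-diff (close m n N≤m N≤n) (close n m N≤n N≤m)
    where
    N = ↧ₙ ε
    close : ∀ m n → N ℕ.≤ m → N ℕ.≤ n → l m ℚ.≤ l n ℚ.+ ε
    close m n N≤m N≤n = begin
      l m                  ≤⟨ l≤u m ⟩
      u m                  ≤⟨ u-anti (ℕₚ.≤⇒≤′ N≤m) ⟩
      u N                  ≤⟨ gap N ⟩
      l N ℚ.+ + 1 / suc N  ≤⟨ ℚₚ.+-mono-≤ (l-mono (ℕₚ.≤⇒≤′ N≤n)) (archimedean ε ε>0 N ℕₚ.≤-refl) ⟩
      l n ℚ.+ ε            ∎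
      where open ℚₚ.≤-Reasoning

invFact : ℕ → ℚ
invFact n = (+ 1 / n !) {{n ℕₚ.!≢0}}

expSum : ℕ → ℚ
expSum zero    = invFact 0
expSum (suc n) = expSum n ℚ.+ invFact (suc n)

1+n≤1+n! : ∀ n → suc n ℕ.≤ suc n !
1+n≤1+n! n = ℕₚ.m≤m*n (suc n) (n !) {{n ℕₚ.!≢0}}

e-nested : Nested (λ n → expSum (suc n)) (λ n → expSum (suc n) ℚ.+ invFact (suc n))
e-nested = record
  { l-inc = λ n → +-incʳ (expSum (suc n)) (invFact-nonNeg (suc (suc n)))
  ; u-dec = λ n → subst (ℚ._≤ expSum (suc n) ℚ.+ invFact (suc n))
                    (sym (ℚₚ.+-assoc (expSum (suc n)) _ _))
                    (ℚₚ.+-monoʳ-≤ (expSum (suc n)) (halve n))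
  ; l≤u   = λ n → +-incʳ (expSum (suc n)) (invFact-nonNeg (suc n))
  ; gap   = λ n → ℚₚ.+-monoʳ-≤ (expSum (suc n))
                    (frac-≤ 1 (suc n !) 1 (suc n) {{suc n ℕₚ.!≢0}}
                      (ℕₚ.*-monoʳ-≤ 1 (1+n≤1+n! n)))
  }
  where
  invFact-nonNeg : ∀ n → 0ℚ ℚ.≤ invFact n
  invFact-nonNeg n = frac-nonNeg 1 (n !) {{n ℕₚ.!≢0}}

  +-incʳ : ∀ a {b} → 0ℚ ℚ.≤ b → a ℚ.≤ a ℚ.+ b
  +-incʳ a {b} p = subst (ℚ._≤ a ℚ.+ b) (ℚₚ.+-identityʳ a) (ℚₚ.+-monoʳ-≤ a p)

  halve : ∀ n → invFact (suc (suc n)) ℚ.+ invFact (suc (suc n)) ℚ.≤ invFact (suc n)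
  halve n = subst (ℚ._≤ invFact (suc n))
    (frac-+ 1 1 (suc (suc n) !) {{suc (suc n) ℕₚ.!≢0}})
    (frac-≤ 2 (suc (suc n) !) 1 (suc n !) {{suc (suc n) ℕₚ.!≢0}} {{suc n ℕₚ.!≢0}}
      (subst (2 ℕ.* suc n ! ℕ.≤_) (sym (ℕₚ.*-identityˡ _))
        (ℕₚ.*-monoˡ-≤ (suc n !) (s≤s (s≤s (z≤n {n}))))))

-- The index is shifted because the interval [expSum n, expSum n + 1/n!]
-- decreases only from n = 1 on.
e : ℝ
e = mkℝ (λ n → expSum (suc n)) (Nested.l-cauchy e-nested)

-- ∛2-digits n = ⌊ 2ⁿ ∛2 ⌋, computed one binary digit at a time.
∛2-digits : ℕ → ℕ
∛2-digits zero = 1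
∛2-digits (suc n) with suc (2 ℕ.* ∛2-digits n) ℕ.^ 3 ℕₚ.≤? 2 ℕ.* (2 ℕ.^ suc n) ℕ.^ 3
... | yes _ = suc (2 ℕ.* ∛2-digits n)
... | no  _ = 2 ℕ.* ∛2-digits n

2^n≢0 : ∀ n → NonZero (2 ℕ.^ n)
2^n≢0 n = ℕₚ.m^n≢0 2 n

scale : ∀ b → 2 ℕ.* (2 ℕ.* b) ℕ.^ 3 ≡ 8 ℕ.* (2 ℕ.* b ℕ.^ 3)
scale = solve 1 (λ b → con 2 :* (con 2 :* b) :^ 3 := con 8 :* (con 2 :* b :^ 3)) refl
  where open +-*-Solver

cube-double : ∀ b → (2 ℕ.* b) ℕ.^ 3 ≡ 8 ℕ.* b ℕ.^ 3
cube-double = solve 1 (λ b → (con 2 :* b) :^ 3 := con 8 :* b :^ 3) refl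
  where open +-*-Solver

double-suc : ∀ b → 2 ℕ.* suc b ≡ suc (suc (2 ℕ.* b))
double-suc = solve 1 (λ b → con 2 :* (con 1 :+ b) := con 2 :+ con 2 :* b) refl
  where open +-*-Solver

digits-lower : ∀ n → ∛2-digits n ℕ.^ 3 ℕ.≤ 2 ℕ.* (2 ℕ.^ n) ℕ.^ 3
digits-lower zero = s≤s z≤n
digits-lower (suc n) with suc (2 ℕ.* ∛2-digits n) ℕ.^ 3 ℕₚ.≤? 2 ℕ.* (2 ℕ.^ suc n) ℕ.^ 3
... | yes p = p
... | no  _ = subst₂ ℕ._≤_ (sym (cube-double (∛2-digits n))) (sym (scale (2 ℕ.^ n)))
                (ℕₚ.*-monoʳ-≤ 8 (digits-lower n))

digits-upper : ∀ n → 2 ℕ.* (2 ℕ.^ n) ℕ.^ 3 ℕ.≤ suc (∛2-digits n) ℕ.^ 3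
digits-upper zero = s≤s (s≤s z≤n)
digits-upper (suc n) with suc (2 ℕ.* ∛2-digits n) ℕ.^ 3 ℕₚ.≤? 2 ℕ.* (2 ℕ.^ suc n) ℕ.^ 3
... | yes _ = subst₂ ℕ._≤_ (sym (scale (2 ℕ.^ n)))
                (trans (sym (cube-double (suc (∛2-digits n))))
                  (cong (ℕ._^ 3) (double-suc (∛2-digits n))))
                (ℕₚ.*-monoʳ-≤ 8 (digits-upper n))
... | no ¬p = ℕₚ.<⇒≤ (ℕₚ.≰⇒> ¬p)

digits-step-lower : ∀ n → 2 ℕ.* ∛2-digits n ℕ.≤ ∛2-digits (suc n)
digits-step-lower n with suc (2 ℕ.* ∛2-digits n) ℕ.^ 3 ℕₚ.≤? 2 ℕ.* (2 ℕ.^ suc n) ℕ.^ 3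
... | yes _ = ℕₚ.n≤1+n _
... | no  _ = ℕₚ.≤-refl

digits-step-upper : ∀ n → suc (∛2-digits (suc n)) ℕ.≤ 2 ℕ.* suc (∛2-digits n)
digits-step-upper n with suc (2 ℕ.* ∛2-digits n) ℕ.^ 3 ℕₚ.≤? 2 ℕ.* (2 ℕ.^ suc n) ℕ.^ 3
... | yes _ = ℕₚ.≤-reflexive (sym (double-suc (∛2-digits n)))
... | no  _ = ℕₚ.≤-trans (ℕₚ.n≤1+n _) (ℕₚ.≤-reflexive (sym (double-suc (∛2-digits n))))

1+n≤2^n : ∀ n → suc n ℕ.≤ 2 ℕ.^ n
1+n≤2^n zero    = s≤s z≤n
1+n≤2^n (suc n) = ℕₚ.≤-trans (s≤s (ℕₚ.m≤n+m (suc n) n))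
  (ℕₚ.≤-trans (ℕₚ.≤-reflexive (cong (suc n ℕ.+_) (sym (ℕₚ.+-identityʳ (suc n)))))
    (ℕₚ.*-monoʳ-≤ 2 (1+n≤2^n n)))

∛2-lower ∛2-upper : ℕ → ℚ
∛2-lower n = (+ ∛2-digits n / 2 ℕ.^ n) {{2^n≢0 n}}
∛2-upper n = (+ suc (∛2-digits n) / 2 ℕ.^ n) {{2^n≢0 n}}

swap : ∀ a b → a ℕ.* (2 ℕ.* b) ≡ 2 ℕ.* a ℕ.* b
swap = solve 2 (λ a b → a :* (con 2 :* b) := con 2 :* a :* b) refl
  where open +-*-Solver

∛2-nested : Nested ∛2-lower ∛2-upper
∛2-nested = record
  { l-inc = λ n → frac-≤ (∛2-digits n) (2 ℕ.^ n) (∛2-digits (suc n)) (2 ℕ.^ suc n) {{2^n≢0 n}} {{2^n≢0 (suc n)}}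
      (subst (ℕ._≤ ∛2-digits (suc n) ℕ.* 2 ℕ.^ n) (sym (swap (∛2-digits n) (2 ℕ.^ n)))
        (ℕₚ.*-monoˡ-≤ (2 ℕ.^ n) (digits-step-lower n)))
  ; u-dec = λ n → frac-≤ (suc (∛2-digits (suc n))) (2 ℕ.^ suc n) (suc (∛2-digits n)) (2 ℕ.^ n) {{2^n≢0 (suc n)}} {{2^n≢0 n}}
      (subst (suc (∛2-digits (suc n)) ℕ.* 2 ℕ.^ n ℕ.≤_) (sym (swap (suc (∛2-digits n)) (2 ℕ.^ n)))
        (ℕₚ.*-monoˡ-≤ (2 ℕ.^ n) (digits-step-upper n)))
  ; l≤u = λ n → frac-≤ (∛2-digits n) (2 ℕ.^ n) (suc (∛2-digits n)) (2 ℕ.^ n) {{2^n≢0 n}} {{2^n≢0 n}}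
      (ℕₚ.*-monoˡ-≤ (2 ℕ.^ n) (ℕₚ.n≤1+n (∛2-digits n)))
  ; gap = λ n → subst (ℚ._≤ ∛2-lower n ℚ.+ + 1 / suc n)
      (trans (sym (frac-+ (∛2-digits n) 1 (2 ℕ.^ n) {{2^n≢0 n}}))
        (cong (λ m → (+ m / 2 ℕ.^ n) {{2^n≢0 n}}) (ℕₚ.+-comm (∛2-digits n) 1)))
      (ℚₚ.+-monoʳ-≤ (∛2-lower n)
        (frac-≤ 1 (2 ℕ.^ n) 1 (suc n) {{2^n≢0 n}}
          (ℕₚ.*-monoʳ-≤ 1 (1+n≤2^n n))))
  }

∛2 : ℝ
∛2 = mkℝ ∛2-lower (Nested.l-cauchy ∛2-nested)

frac-cube : ∀ a b .{{_ : NonZero b}} .{{_ : NonZero (b ℕ.^ 3)}} →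
            (+ a / b) ℚ.* ((+ a / b) ℚ.* ((+ a / b) ℚ.* 1ℚ)) ≡ + (a ℕ.^ 3) / b ℕ.^ 3
frac-cube a b {{b≢0}} = trans (cong (λ q → (+ a / b) ℚ.* ((+ a / b) ℚ.* q)) (frac-* a b 1 1 {{b≢0}} {{_}} {{nz₁}}))
  (trans (cong ((+ a / b) ℚ.*_) (frac-* a b (a ℕ.* 1) (b ℕ.* 1) {{b≢0}} {{nz₁}} {{nz₂}}))
    (frac-* a b (a ℕ.* (a ℕ.* 1)) (b ℕ.* (b ℕ.* 1)) {{b≢0}} {{nz₂}}))
  where
  nz₁ : NonZero (b ℕ.* 1)
  nz₁ = ℕₚ.m^n≢0 b 1
  nz₂ : NonZero (b ℕ.* (b ℕ.* 1))
  nz₂ = ℕₚ.m^n≢0 b 2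

cube-lower : ∀ n → seq (∛2 ^ 3) n ℚ.≤ + 2 / 1
cube-lower n = subst (ℚ._≤ + 2 / 1) (sym (frac-cube (∛2-digits n) (2 ℕ.^ n) {{2^n≢0 n}} {{nz}}))
  (frac-≤ (∛2-digits n ℕ.^ 3) ((2 ℕ.^ n) ℕ.^ 3) 2 1 {{nz}}
    (subst (ℕ._≤ 2 ℕ.* (2 ℕ.^ n) ℕ.^ 3) (sym (ℕₚ.*-identityʳ _)) (digits-lower n)))
  where
  nz : NonZero ((2 ℕ.^ n) ℕ.^ 3)
  nz = ℕₚ.m^n≢0 (2 ℕ.^ n) 3 {{2^n≢0 n}}

cube-upper : ∀ n → + 2 / 1 ℚ.≤ ∛2-upper n ℚ.* (∛2-upper n ℚ.* (∛2-upper n ℚ.* 1ℚ))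
cube-upper n = subst (+ 2 / 1 ℚ.≤_) (sym (frac-cube (suc (∛2-digits n)) (2 ℕ.^ n) {{2^n≢0 n}} {{nz}}))
  (frac-≤ 2 1 (suc (∛2-digits n) ℕ.^ 3) ((2 ℕ.^ n) ℕ.^ 3) {{_}} {{nz}}
    (subst (2 ℕ.* (2 ℕ.^ n) ℕ.^ 3 ℕ.≤_) (sym (ℕₚ.*-identityʳ _)) (digits-upper n)))
  where
  nz : NonZero ((2 ℕ.^ n) ℕ.^ 3)
  nz = ℕₚ.m^n≢0 (2 ℕ.^ n) 3 {{2^n≢0 n}}

-- The extra factor δ below satisfies 12 δ = ε, and u³ - l³ = (u - l) (u² + u l + l²)
-- is at most 12 (u - l) for 0 ≤ l ≤ u ≤ 2.
∛2-cubed : ∛2 ^ 3 ≃ fromℕ 2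
∛2-cubed = below , above
  where
  below : ∛2 ^ 3 ≤ fromℕ 2
  below ε ε>0 = 0 , λ n _ → ℚₚ.≤-trans (cube-lower n)
    (ℚₚ.+-monoʳ-≤ (+ 2 / 1) (ℚₚ.<⇒≤ ε>0))

  above : fromℕ 2 ≤ ∛2 ^ 3
  above ε ε>0 = ↧ₙ δ , bound
    where
    δ = ε ℚ.* (+ 1 / 12)
    δ>0 : 0ℚ ℚ.< δ
    δ>0 = ℚₚ.positive⁻¹ δ {{ℚₚ.pos*pos⇒pos ε {{ℚ.positive ε>0}} (+ 1 / 12)}}

    12δ≡ε : (+ 12 / 1) ℚ.* δ ≡ ε
    12δ≡ε = trans (solve 1 (λ x → con (+ 12 / 1) :* (x :* con (+ 1 / 12)) := x) refl ε) refl
      where open ℚSolver.+-*-Solver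

    bound : ∀ n → ↧ₙ δ ℕ.≤ n → + 2 / 1 ℚ.≤ seq (∛2 ^ 3) n ℚ.+ ε
    bound n N≤n = begin
      + 2 / 1
        ≤⟨ cube-upper n ⟩
      u ℚ.* (u ℚ.* (u ℚ.* 1ℚ))
        ≡⟨ expand u l ⟩
      l ℚ.* (l ℚ.* (l ℚ.* 1ℚ)) ℚ.+ (u ℚ.* u ℚ.+ u ℚ.* l ℚ.+ l ℚ.* l) ℚ.* (u ℚ.- l)
        ≤⟨ ℚₚ.+-monoʳ-≤ (l ℚ.* (l ℚ.* (l ℚ.* 1ℚ)))
             (*-mono-≤ 0≤quad (ℚₚ.<⇒≤ δ>0) quad≤12 diff≤δ) ⟩
      l ℚ.* (l ℚ.* (l ℚ.* 1ℚ)) ℚ.+ (+ 12 / 1) ℚ.* δ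
        ≡⟨ cong (l ℚ.* (l ℚ.* (l ℚ.* 1ℚ)) ℚ.+_) 12δ≡ε ⟩
      l ℚ.* (l ℚ.* (l ℚ.* 1ℚ)) ℚ.+ ε ∎
      where
      open ℚₚ.≤-Reasoning
      open Nested ∛2-nested
      l = ∛2-lower n
      u = ∛2-upper n
      2ℚ = + 2 / 1
      expand : ∀ u l → u ℚ.* (u ℚ.* (u ℚ.* 1ℚ)) ≡
        l ℚ.* (l ℚ.* (l ℚ.* 1ℚ)) ℚ.+ (u ℚ.* u ℚ.+ u ℚ.* l ℚ.+ l ℚ.* l) ℚ.* (u ℚ.- l)
      expand = solve 2 (λ u l → u :* (u :* (u :* con 1ℚ)) :=
        l :* (l :* (l :* con 1ℚ)) :+ (u :* u :+ u :* l :+ l :* l) :* (u :- l)) refl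
        where open ℚSolver.+-*-Solver
      0≤l : 0ℚ ℚ.≤ l
      0≤l = frac-nonNeg (∛2-digits n) (2 ℕ.^ n) {{2^n≢0 n}}
      0≤u : 0ℚ ℚ.≤ u
      0≤u = ℚₚ.≤-trans 0≤l (l≤u n)
      0≤2 : 0ℚ ℚ.≤ 2ℚ
      0≤2 = frac-nonNeg 2 1
      u≤2 : u ℚ.≤ 2ℚ
      u≤2 = u-anti (ℕₚ.≤⇒≤′ (z≤n {n}))
      l≤2 : l ℚ.≤ 2ℚ
      l≤2 = ℚₚ.≤-trans (l≤u n) u≤2
      0≤* : ∀ {a b} → 0ℚ ℚ.≤ a → 0ℚ ℚ.≤ b → 0ℚ ℚ.≤ a ℚ.* b
      0≤* {a} {b} p q = subst (ℚ._≤ a ℚ.* b) (ℚₚ.*-zeroʳ a)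
        (ℚₚ.*-monoˡ-≤-nonNeg a {{ℚ.nonNegative p}} q)
      0≤quad : 0ℚ ℚ.≤ u ℚ.* u ℚ.+ u ℚ.* l ℚ.+ l ℚ.* l
      0≤quad = ℚₚ.+-mono-≤ (ℚₚ.+-mono-≤ (0≤* 0≤u 0≤u) (0≤* 0≤u 0≤l)) (0≤* 0≤l 0≤l)
      quad≤12 : u ℚ.* u ℚ.+ u ℚ.* l ℚ.+ l ℚ.* l ℚ.≤ + 12 / 1
      quad≤12 = ℚₚ.+-mono-≤ (ℚₚ.+-mono-≤ (*-mono-≤ 0≤u 0≤2 u≤2 u≤2) (*-mono-≤ 0≤u 0≤2 u≤2 l≤2))
                  (*-mono-≤ 0≤l 0≤2 l≤2 l≤2)
      diff≤δ : u ℚ.- l ℚ.≤ δ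
      diff≤δ = begin
        u ℚ.- l                    ≤⟨ ℚₚ.+-monoˡ-≤ (ℚ.- l) (gap n) ⟩
        l ℚ.+ + 1 / suc n ℚ.- l    ≡⟨ cancel l (+ 1 / suc n) ⟩
        + 1 / suc n                ≤⟨ archimedean δ δ>0 n N≤n ⟩
        δ                          ∎
        where
        cancel : ∀ a b → a ℚ.+ b ℚ.- a ≡ b
        cancel = solve 2 (λ a b → a :+ b :- a := b) refl
          where open ℚSolver.+-*-Solver

{-# OPTIONS --safe #-}

-- Colour the ground set with k colours so that a k!/kᵏ ≥ 3⁻ᵏ proportion of F becomes rainbow
-- (averaging over all colourings), and write A_i for the element of colour i in a rainbow set A.
-- On rainbow sets the tensor T(A,B,C) = ∏_i ([A_i = B_i] + [B_i = C_i] + [A_i = C_i] − 1) vanishes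
-- unless A, B, C are equal or form a sunflower, so on a sunflower-free family it is diagonal with
-- nonzero diagonal, and its slice rank is the number of rainbow sets. On the other hand, after
-- removing one element from each colour class, T becomes a polynomial of total degree at most 2k in
-- the indicator variables of the remaining at most M − k ≤ kN elements, N = ⌈M/k⌉ − 1. Each of its
-- monomials has degree at most c = ⌈2k/3⌉ in one of A, B, C, so that its slice rank is at most
-- 3 Σ_{j ≤ c} C(kN, j) ≤ 3 Nᶜ (1 + 1/N)^{kN} ≤ 3 · 3ᵏ Nᶜ.
-- Altogether |F| ≤ 3 · 9ᵏ Nᶜ, and 9 ≤ 5/4 · 3 · 5/2 ≤ ∛2 · 3 · e.

module Submission where

-- Inequalities between powers and factorials.

module Arithmetic where

  open import Data.Nat.Base
  open import Data.Nat.Properties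
  open import Data.Nat.Solver using (module +-*-Solver)
  open import Relation.Binary.PropositionalEquality

  private
    -- The right side exceeds the left by (j + 1) n - j², which for n = j + d is `j * d + (j + d)`.
    quadratic-step : ∀ n j d → n ≡ j + d →
                 (n * n + j * n + j * j) * suc n ≤ n * (n * n + suc j * n + suc j * suc j)
    quadratic-step n j d refl = ≤-trans (m≤m+n _ (j * d + (j + d))) (≤-reflexive
      (solve 2 (λ j d → let n = j :+ d ; s = con 1 :+ j in
         (n :* n :+ j :* n :+ j :* j) :* (con 1 :+ n) :+ (j :* d :+ (j :+ d)) :=
         n :* (n :* n :+ s :* n :+ s :* s)) refl j d))
      where open +-*-Solver

  -- (1 + 1/n)^j ≤ 1 + j/n + (j/n)² for j ≤ n, cleared of denominators.
  [1+n]^j-bound : ∀ n j → j ≤ n → suc n ^ j * (n * n) ≤ n ^ j * (n * n + j * n + j * j)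
  [1+n]^j-bound n zero _ = ≤-reflexive (cong (1 *_) (sym (trans (+-identityʳ _) (+-identityʳ _))))
  [1+n]^j-bound n (suc j) j<n = begin
    suc n * suc n ^ j * (n * n)
      ≡⟨ *-assoc (suc n) (suc n ^ j) (n * n) ⟩
    suc n * (suc n ^ j * (n * n))
      ≤⟨ *-monoʳ-≤ (suc n) ([1+n]^j-bound n j (<⇒≤ j<n)) ⟩
    suc n * (n ^ j * (n * n + j * n + j * j))
      ≡⟨ solve 3 (λ a b c → a :* (b :* c) := b :* (c :* a)) refl (suc n) (n ^ j) _ ⟩
    n ^ j * ((n * n + j * n + j * j) * suc n)
      ≤⟨ *-monoʳ-≤ (n ^ j) (quadratic-step n j (n ∸ j) (sym (m+[n∸m]≡n (<⇒≤ j<n)))) ⟩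
    n ^ j * (n * (n * n + suc j * n + suc j * suc j))
      ≡⟨ solve 3 (λ b n c → b :* (n :* c) := n :* b :* c) refl (n ^ j) n _ ⟩
    n * n ^ j * (n * n + suc j * n + suc j * suc j) ∎
    where
    open ≤-Reasoning
    open +-*-Solver

  [m*n]^o≡m^o*n^o : ∀ m n o → (m * n) ^ o ≡ m ^ o * n ^ o
  [m*n]^o≡m^o*n^o m n zero    = refl
  [m*n]^o≡m^o*n^o m n (suc o) = trans (cong (m * n *_) ([m*n]^o≡m^o*n^o m n o))
    (solve 4 (λ m n a b → m :* n :* (a :* b) := m :* a :* (n :* b)) refl m n (m ^ o) (n ^ o))
    where open +-*-Solver

  -- At j = n the quadratic factor of the preceding bound is 3n². This is (1 + 1/n)^n ≤ 3 without
  -- fractions.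
  [1+n]^n≤3n^n : ∀ n → suc n ^ n ≤ 3 * n ^ n
  [1+n]^n≤3n^n zero = s≤s z≤n
  [1+n]^n≤3n^n n@(suc _) = *-cancelʳ-≤ _ _ (n * n) (begin
    suc n ^ n * (n * n)             ≤⟨ [1+n]^j-bound n n ≤-refl ⟩
    n ^ n * (n * n + n * n + n * n) ≡⟨ solve 2 (λ a b → a :* (b :+ b :+ b) := con 3 :* a :* b) refl (n ^ n) (n * n) ⟩
    3 * n ^ n * (n * n)             ∎)
    where
    open ≤-Reasoning
    open +-*-Solver

  -- By the preceding bound the quotient n^n / n! grows by a factor of at most 3 from n to n + 1.
  n^n≤3^n*n! : ∀ n → n ^ n ≤ 3 ^ n * n !
  n^n≤3^n*n! zero    = ≤-refl
  n^n≤3^n*n! (suc n) = begin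
    suc n * suc n ^ n            ≤⟨ *-monoʳ-≤ (suc n) ([1+n]^n≤3n^n n) ⟩
    suc n * (3 * n ^ n)          ≤⟨ *-monoʳ-≤ (suc n) (*-monoʳ-≤ 3 (n^n≤3^n*n! n)) ⟩
    suc n * (3 * (3 ^ n * n !))  ≡⟨ solve 3 (λ a b c → a :* (con 3 :* (b :* c)) := con 3 :* b :* (a :* c)) refl (suc n) (3 ^ n) (n !) ⟩
    3 * 3 ^ n * (suc n * n !)    ∎
    where
    open ≤-Reasoning
    open +-*-Solver

-- Slice rank of 3-tensors, and its value on diagonal tensors.

module SliceRank where

  open import Data.Fin.Base using (Fin; zero; suc; punchIn)
  open import Data.Fin.Properties using (punchInᵢ≢i; punchIn-injective; all?; ¬∀⟶∃¬)
  open import Data.Integer.Base using (ℤ; 0ℤ; _+_; _*_; _-_)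
  open import Data.Integer.Properties
  open import Data.Integer.Solver using (module +-*-Solver)
  open import Data.List.Base using (List; []; _∷_; length; map)
  open import Data.List.Membership.Propositional using (_∈_)
  open import Data.List.Membership.Propositional.Properties using (∈-map⁺)
  open import Data.List.Properties using (length-map)
  open import Data.List.Relation.Unary.Any using (here; there)
  import Data.Nat.Base as ℕ
  import Data.Nat.Properties as ℕ
  open import Data.Product.Base using (∃; _×_; _,_; proj₁; proj₂)
  open import Data.Sum.Base using (inj₁; inj₂)
  open import Relation.Binary.PropositionalEquality
  open import Relation.Nullary using (¬_; yes; no; contradiction)

  Tensor : Set → Set
  Tensor X = X → X → X → ℤ

  infix 4 _≗₃_
  _≗₃_ : ∀ {X} → Tensor X → Tensor X → Set
  S ≗₃ T = ∀ x y z → S x y z ≡ T x y z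

  data Axis : Set where
    X-axis Y-axis Z-axis : Axis

  slice : ∀ {X} → Axis → (X → ℤ) → (X → X → ℤ) → Tensor X
  slice X-axis f F x y z = f x * F y z
  slice Y-axis f F x y z = f y * F x z
  slice Z-axis f F x y z = f z * F x y

  -- Cofactors `F` are arbitrary, and slices with the same member of `L` merge into one, so a tensor
  -- in the span has slice rank at most the length of `L`. Equations are pointwise, which avoids
  -- function extensionality.
  data Span {X : Set} (L : List (Axis × (X → ℤ))) : Tensor X → Set where
    zero  : ∀ {T} → T ≗₃ (λ _ _ _ → 0ℤ) → Span L T
    plus  : ∀ {S T U} → U ≗₃ (λ x y z → S x y z + T x y z) → Span L S → Span L T → Span L U
    single : ∀ {T d f} F → (d , f) ∈ L → T ≗₃ slice d f F → Span L T

  -- Gaussian elimination along an axis with pivot p, followed by deletion of p from every axis.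
  module _ {N} (p : Fin (ℕ.suc N)) (f : Fin (ℕ.suc N) → ℤ) where

    private
      q : Fin N → Fin (ℕ.suc N)
      q = punchIn p

    eliminate : Axis → Tensor (Fin (ℕ.suc N)) → Tensor (Fin N)
    eliminate X-axis T x y z = f p * T (q x) (q y) (q z) - f (q x) * T p (q y) (q z)
    eliminate Y-axis T x y z = f p * T (q x) (q y) (q z) - f (q y) * T (q x) p (q z)
    eliminate Z-axis T x y z = f p * T (q x) (q y) (q z) - f (q z) * T (q x) (q y) p

    private
      same other : (Fin (ℕ.suc N) → ℤ) → Fin N → ℤ
      same  g x = f p * g (q x) - f (q x) * g p
      other g x = g (q x)

    eliminateFun : Axis → Axis × (Fin (ℕ.suc N) → ℤ) → Axis × (Fin N → ℤ)
    eliminateFun X-axis (X-axis , g) = X-axis , same g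
    eliminateFun X-axis (Y-axis , g) = Y-axis , other g
    eliminateFun X-axis (Z-axis , g) = Z-axis , other g
    eliminateFun Y-axis (X-axis , g) = X-axis , other g
    eliminateFun Y-axis (Y-axis , g) = Y-axis , same g
    eliminateFun Y-axis (Z-axis , g) = Z-axis , other g
    eliminateFun Z-axis (X-axis , g) = X-axis , other g
    eliminateFun Z-axis (Y-axis , g) = Y-axis , other g
    eliminateFun Z-axis (Z-axis , g) = Z-axis , same g

    private
      factor-other : ∀ a b g u v → a * (g * u) - b * (g * v) ≡ g * (a * u - b * v)
      factor-other = solve 5 (λ a b g u v → a :* (g :* u) :- b :* (g :* v) := g :* (a :* u :- b :* v)) refl
        where open +-*-Solver

      factor-same : ∀ a b g h u → a * (g * u) - b * (h * u) ≡ (a * g - b * h) * u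
      factor-same = solve 5 (λ a b g h u → a :* (g :* u) :- b :* (h :* u) := (a :* g :- b :* h) :* u) refl
        where open +-*-Solver

    -- Along the pivot axis the one-variable function is reduced and the cofactor only restricted;
    -- along another axis the function is only restricted and the elimination acts on the cofactor.
    -- Multiplying by `f p` instead of dividing keeps everything integral.
    eliminate-slice : ∀ d (s : Axis × (Fin (ℕ.suc N) → ℤ)) F → let (d′ , g) = s in ∃ λ F′ →
      eliminate d (slice d′ g F) ≗₃ slice (proj₁ (eliminateFun d s)) (proj₂ (eliminateFun d s)) F′
    eliminate-slice X-axis (X-axis , g) F = _ , λ x y z → factor-same (f p) (f (q x)) (g (q x)) (g p) _
    eliminate-slice X-axis (Y-axis , g) F = _ , λ x y z → factor-other (f p) (f (q x)) (g (q y)) (F (q x) (q z)) (F p (q z))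
    eliminate-slice X-axis (Z-axis , g) F = _ , λ x y z → factor-other (f p) (f (q x)) (g (q z)) (F (q x) (q y)) (F p (q y))
    eliminate-slice Y-axis (X-axis , g) F = _ , λ x y z → factor-other (f p) (f (q y)) (g (q x)) (F (q y) (q z)) (F p (q z))
    eliminate-slice Y-axis (Y-axis , g) F = _ , λ x y z → factor-same (f p) (f (q y)) (g (q y)) (g p) _
    eliminate-slice Y-axis (Z-axis , g) F = _ , λ x y z → factor-other (f p) (f (q y)) (g (q z)) (F (q x) (q y)) (F (q x) p)
    eliminate-slice Z-axis (X-axis , g) F = _ , λ x y z → factor-other (f p) (f (q z)) (g (q x)) (F (q y) (q z)) (F (q y) p)
    eliminate-slice Z-axis (Y-axis , g) F = _ , λ x y z → factor-other (f p) (f (q z)) (g (q y)) (F (q x) (q z)) (F (q x) p)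
    eliminate-slice Z-axis (Z-axis , g) F = _ , λ x y z → factor-same (f p) (f (q z)) (g (q z)) (g p) _

    -- The function turns into `f p * f (q x) - f (q x) * f p`, so the pivot slice disappears.
    eliminate-pivot : ∀ d F → eliminate d (slice d f F) ≗₃ λ _ _ _ → 0ℤ
    eliminate-pivot d F = vanish d
      where
      cancel : ∀ a b u → a * (b * u) - b * (a * u) ≡ 0ℤ
      cancel = solve 3 (λ a b u → a :* (b :* u) :- b :* (a :* u) := con 0ℤ) refl
        where open +-*-Solver
      vanish : ∀ d → eliminate d (slice d f F) ≗₃ λ _ _ _ → 0ℤ
      vanish X-axis x y z = cancel (f p) (f (q x)) _
      vanish Y-axis x y z = cancel (f p) (f (q y)) _
      vanish Z-axis x y z = cancel (f p) (f (q z)) _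

    eliminate-cong : ∀ d {S T} → S ≗₃ T → eliminate d S ≗₃ eliminate d T
    eliminate-cong X-axis eq x y z = cong₂ (λ a b → f p * a - f (q x) * b) (eq _ _ _) (eq _ _ _)
    eliminate-cong Y-axis eq x y z = cong₂ (λ a b → f p * a - f (q y) * b) (eq _ _ _) (eq _ _ _)
    eliminate-cong Z-axis eq x y z = cong₂ (λ a b → f p * a - f (q z) * b) (eq _ _ _) (eq _ _ _)

    eliminate-0 : ∀ d → eliminate d (λ _ _ _ → 0ℤ) ≗₃ λ _ _ _ → 0ℤ
    eliminate-0 d = vanish d
      where
      cancel : ∀ a b → a * 0ℤ - b * 0ℤ ≡ 0ℤ
      cancel = solve 2 (λ a b → a :* con 0ℤ :- b :* con 0ℤ := con 0ℤ) refl
        where open +-*-Solver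
      vanish : ∀ d → eliminate d (λ _ _ _ → 0ℤ) ≗₃ λ _ _ _ → 0ℤ
      vanish X-axis x y z = cancel (f p) (f (q x))
      vanish Y-axis x y z = cancel (f p) (f (q y))
      vanish Z-axis x y z = cancel (f p) (f (q z))

    eliminate-+ : ∀ d S T → eliminate d (λ x y z → S x y z + T x y z) ≗₃
                            λ x y z → eliminate d S x y z + eliminate d T x y z
    eliminate-+ d S T = add d
      where
      rearrange : ∀ a b s t s′ t′ → a * (s + t) - b * (s′ + t′) ≡ (a * s - b * s′) + (a * t - b * t′)
      rearrange = solve 6 (λ a b s t s′ t′ →
        a :* (s :+ t) :- b :* (s′ :+ t′) := (a :* s :- b :* s′) :+ (a :* t :- b :* t′)) refl
        where open +-*-Solver
      add : ∀ d → eliminate d (λ x y z → S x y z + T x y z) ≗₃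
                  λ x y z → eliminate d S x y z + eliminate d T x y z
      add X-axis x y z = rearrange (f p) (f (q x)) (S (q x) (q y) (q z)) (T (q x) (q y) (q z)) (S p (q y) (q z)) (T p (q y) (q z))
      add Y-axis x y z = rearrange (f p) (f (q y)) (S (q x) (q y) (q z)) (T (q x) (q y) (q z)) (S (q x) p (q z)) (T (q x) p (q z))
      add Z-axis x y z = rearrange (f p) (f (q z)) (S (q x) (q y) (q z)) (T (q x) (q y) (q z)) (S (q x) (q y) p) (T (q x) (q y) p)

    eliminate-span : ∀ {d L T} → Span ((d , f) ∷ L) T → Span (map (eliminateFun d) L) (eliminate d T)
    eliminate-span {d} (zero eq) =
      zero λ x y z → trans (eliminate-cong d eq x y z) (eliminate-0 d x y z)
    eliminate-span {d} (plus {S} {T} eq s t) =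
      plus (λ x y z → trans (eliminate-cong d eq x y z) (eliminate-+ d S T x y z))
           (eliminate-span s) (eliminate-span t)
    eliminate-span {d} (single F (here refl) eq) =
      zero λ x y z → trans (eliminate-cong d eq x y z) (eliminate-pivot d F x y z)
    eliminate-span {d} (single F (there f∈L) eq) with F′ , eq′ ← eliminate-slice d _ F =
      single F′ (∈-map⁺ (eliminateFun d) f∈L) λ x y z → trans (eliminate-cong d eq x y z) (eq′ x y z)

  record Diagonal {N} (T : Tensor (Fin N)) : Set where
    field
      off-diagonal : ∀ x y z → ¬ (x ≡ y × y ≡ z) → T x y z ≡ 0ℤ
      on-diagonal  : ∀ x → T x x x ≢ 0ℤ

  open Diagonal

  module _ {N} (p : Fin (ℕ.suc N)) (f : Fin (ℕ.suc N) → ℤ) (fp≢0 : f p ≢ 0ℤ) where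

    private
      q : Fin N → Fin (ℕ.suc N)
      q = punchIn p

      simplify : ∀ {a b t s} → s ≡ 0ℤ → a * t - b * s ≡ a * t
      simplify {a} {b} {t} refl = solve 3 (λ a b t → a :* t :- b :* con 0ℤ := a :* t) refl a b t
        where open +-*-Solver

    -- The subtracted entry has exactly one coordinate equal to p, so it vanishes.
    eliminate-diagonal-tensor : ∀ {T} → Diagonal T → ∀ d x y z →
                                eliminate p f d T x y z ≡ f p * T (q x) (q y) (q z)
    eliminate-diagonal-tensor D X-axis x y z =
      simplify {f p} {f (q x)} (off-diagonal D _ _ _ λ (eq , _) → punchInᵢ≢i p y (sym eq))
    eliminate-diagonal-tensor D Y-axis x y z =
      simplify {f p} {f (q y)} (off-diagonal D _ _ _ λ (eq , _) → punchInᵢ≢i p x eq)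
    eliminate-diagonal-tensor D Z-axis x y z =
      simplify {f p} {f (q z)} (off-diagonal D _ _ _ λ (_ , eq) → punchInᵢ≢i p y eq)

    -- The surviving diagonal entries are multiplied by `f p`, and the integers have no zero
    -- divisors.
    eliminate-diagonal : ∀ {T} → Diagonal T → ∀ d → Diagonal (eliminate p f d T)
    eliminate-diagonal D d .off-diagonal x y z ne =
      trans (eliminate-diagonal-tensor D d x y z) (trans (cong (f p *_) eq) (*-zeroʳ (f p)))
      where
      eq = off-diagonal D (q x) (q y) (q z)
             λ (e₁ , e₂) → ne (punchIn-injective p x y e₁ , punchIn-injective p y z e₂)
    eliminate-diagonal D d .on-diagonal x eq
      with i*j≡0⇒i≡0∨j≡0 (f p) (trans (sym (eliminate-diagonal-tensor D d x x x)) eq)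
    ... | inj₁ fp≡0 = fp≢0 fp≡0
    ... | inj₂ T≡0  = on-diagonal D (q x) T≡0

  -- Treats a function that offers no pivot: its slices contribute nothing.
  span-drop : ∀ {X d} {f : X → ℤ} {L T} → (∀ x → f x ≡ 0ℤ) → Span ((d , f) ∷ L) T → Span L T
  span-drop f≡0 (zero eq)     = zero eq
  span-drop f≡0 (plus eq s t) = plus eq (span-drop f≡0 s) (span-drop f≡0 t)
  span-drop {d = d} f≡0 (single F (here refl) eq) = zero λ x y z → trans (eq x y z) (vanish d x y z)
    where
    vanish : ∀ d → slice d _ F ≗₃ λ _ _ _ → 0ℤ
    vanish X-axis x y z = cong (_* F y z) (f≡0 x)
    vanish Y-axis x y z = cong (_* F x z) (f≡0 y)
    vanish Z-axis x y z = cong (_* F x y) (f≡0 z)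
  span-drop f≡0 (single F (there f∈L) eq) = single F f∈L eq

  span-[] : ∀ {X} {T : Tensor X} → Span [] T → T ≗₃ λ _ _ _ → 0ℤ
  span-[] (zero eq)     x y z = eq x y z
  span-[] (plus eq s t) x y z = trans (eq x y z) (cong₂ _+_ (span-[] s x y z) (span-[] t x y z))

  -- Tao's lemma, by induction on the number of slices. A function without pivot is dropped; any
  -- other is used for an elimination, which lowers both the size of the tensor and the number of
  -- slices by one and keeps the tensor diagonal. Once the slices run out, a nonzero diagonal entry
  -- would be zero.
  slice-rank-diagonal : ∀ {N} L {T : Tensor (Fin N)} → Diagonal T → Span L T → N ℕ.≤ length L
  slice-rank-diagonal L = go (length L) L refl
    where
    -- The recursion runs on the length `r`, because elimination replaces the tail of the list by
    -- its image under a map.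
    go : ∀ {N} r L → length L ≡ r → {T : Tensor (Fin N)} → Diagonal T → Span L T → N ℕ.≤ r
    go {ℕ.zero}  _ _  _ _ _ = ℕ.z≤n
    go {ℕ.suc N} _ [] _ D s = contradiction (span-[] s zero zero zero) (on-diagonal D zero)
    go {ℕ.suc N} (ℕ.suc r) ((d , f) ∷ L) len D s with all? (λ x → f x ≟ 0ℤ)
    ... | yes f≡0 = ℕ.m≤n⇒m≤1+n (go r L (ℕ.suc-injective len) D (span-drop f≡0 s))
    ... | no ¬f≡0 with p , fp≢0 ← ¬∀⟶∃¬ _ _ (λ x → f x ≟ 0ℤ) ¬f≡0 =
      ℕ.s≤s (go r (map (eliminateFun p f d) L)
                (trans (length-map (eliminateFun p f d) L) (ℕ.suc-injective len))
                (eliminate-diagonal p f fp≢0 D d) (eliminate-span p f s))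

-- Subsets of bounded size and their number.

module Subsets where

  open import Data.Fin.Subset using (Subset; inside; outside; ∣_∣; _⊆_; _∪_)
  open import Data.Fin.Subset.Properties
  open import Data.List.Base using (List; []; _∷_; _++_; length; map)
  open import Data.List.Membership.Propositional using (_∈_)
  open import Data.List.Membership.Propositional.Properties using (∈-map⁺; ∈-++⁺ˡ; ∈-++⁺ʳ)
  open import Data.List.Properties using (length-map; length-++)
  open import Data.List.Relation.Unary.Any using (here)
  open import Data.Nat.Base
  open import Data.Nat.Properties
  open import Data.Nat.Solver using (module +-*-Solver)
  open import Data.Sum.Base using (inj₁; inj₂)
  open import Data.Vec.Base using ([]; _∷_)
  import Data.Vec.Base as Vec
  open import Relation.Binary.PropositionalEquality
  open import Relation.Nullary using (contradiction)

  ∣p∪q∣≤∣p∣+∣q∣ : ∀ {n} (p q : Subset n) → ∣ p ∪ q ∣ ≤ ∣ p ∣ + ∣ q ∣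
  ∣p∪q∣≤∣p∣+∣q∣ []            []            = z≤n
  ∣p∪q∣≤∣p∣+∣q∣ (outside ∷ p) (outside ∷ q) = ∣p∪q∣≤∣p∣+∣q∣ p q
  ∣p∪q∣≤∣p∣+∣q∣ (outside ∷ p) (inside  ∷ q) = ≤-trans (s≤s (∣p∪q∣≤∣p∣+∣q∣ p q)) (≤-reflexive (sym (+-suc _ _)))
  ∣p∪q∣≤∣p∣+∣q∣ (inside  ∷ p) (outside ∷ q) = s≤s (∣p∪q∣≤∣p∣+∣q∣ p q)
  ∣p∪q∣≤∣p∣+∣q∣ (inside  ∷ p) (inside  ∷ q) = s≤s (≤-trans (∣p∪q∣≤∣p∣+∣q∣ p q) (+-monoʳ-≤ ∣ p ∣ (n≤1+n _)))

  ∪-least : ∀ {n} {p q r : Subset n} → p ⊆ r → q ⊆ r → p ∪ q ⊆ r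
  ∪-least {p = p} {q} p⊆r q⊆r x∈p∪q with x∈p∪q⁻ p q x∈p∪q
  ... | inj₁ x∈p = p⊆r x∈p
  ... | inj₂ x∈q = q⊆r x∈q

  smallSubsets : ∀ {n} → Subset n → ℕ → List (Subset n)
  smallSubsets []            c       = [] ∷ []
  smallSubsets (outside ∷ U) c       = map (outside ∷_) (smallSubsets U c)
  smallSubsets (inside  ∷ U) zero    = map (outside ∷_) (smallSubsets U zero)
  smallSubsets (inside  ∷ U) (suc c) =
    map (outside ∷_) (smallSubsets U (suc c)) ++ map (inside ∷_) (smallSubsets U c)

  ∈-smallSubsets : ∀ {n} (U : Subset n) c {S} → S ⊆ U → ∣ S ∣ ≤ c → S ∈ smallSubsets U c
  ∈-smallSubsets [] c {[]} _ _ = here refl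
  ∈-smallSubsets (outside ∷ U) c {outside ∷ S} S⊆U S≤c =
    ∈-map⁺ (outside ∷_) (∈-smallSubsets U c (drop-∷-⊆ S⊆U) S≤c)
  ∈-smallSubsets (outside ∷ U) c {inside ∷ S} S⊆U S≤c = contradiction (S⊆U Vec.here) λ ()
  ∈-smallSubsets (inside ∷ U) zero {outside ∷ S} S⊆U S≤c =
    ∈-map⁺ (outside ∷_) (∈-smallSubsets U zero (drop-∷-⊆ S⊆U) S≤c)
  ∈-smallSubsets (inside ∷ U) (suc c) {outside ∷ S} S⊆U S≤c =
    ∈-++⁺ˡ (∈-map⁺ (outside ∷_) (∈-smallSubsets U (suc c) (drop-∷-⊆ S⊆U) S≤c))
  ∈-smallSubsets (inside ∷ U) (suc c) {inside ∷ S} S⊆U S≤c =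
    ∈-++⁺ʳ _ (∈-map⁺ (inside ∷_) (∈-smallSubsets U c (drop-∷-⊆ S⊆U) (s≤s⁻¹ S≤c)))

  -- Rankin's trick: Σ_{j ≤ c} C(u, j) ≤ N^c (1 + 1/N)^u.
  length-smallSubsets : ∀ {n} N .{{_ : NonZero N}} (U : Subset n) c →
                        length (smallSubsets U c) * N ^ ∣ U ∣ ≤ N ^ c * suc N ^ ∣ U ∣
  length-smallSubsets N [] c = *-mono-≤ (m^n>0 N c) (≤-refl {1})
  length-smallSubsets N (outside ∷ U) c =
    subst (λ ℓ → ℓ * N ^ ∣ U ∣ ≤ N ^ c * suc N ^ ∣ U ∣)
      (sym (length-map (outside ∷_) (smallSubsets U c))) (length-smallSubsets N U c)
  length-smallSubsets N (inside ∷ U) zero = begin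
    length (map (outside ∷_) (smallSubsets U zero)) * (N * N ^ u)
                                ≡⟨ cong (_* (N * N ^ u)) (length-map (outside ∷_) (smallSubsets U zero)) ⟩
    ℓ * (N * N ^ u)             ≡⟨ solve 3 (λ a b c → a :* (b :* c) := b :* (a :* c)) refl ℓ N (N ^ u) ⟩
    N * (ℓ * N ^ u)             ≤⟨ *-mono-≤ (n≤1+n N) (length-smallSubsets N U zero) ⟩
    suc N * (1 * suc N ^ u)     ≡⟨ solve 2 (λ a b → a :* (con 1 :* b) := con 1 :* (a :* b)) refl (suc N) (suc N ^ u) ⟩
    1 * (suc N * suc N ^ u)     ∎
    where
    open ≤-Reasoning
    open +-*-Solver
    u = ∣ U ∣
    ℓ = length (smallSubsets U zero)
  length-smallSubsets N (inside ∷ U) (suc c) = begin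
    length (map (outside ∷_) (smallSubsets U (suc c)) ++ map (inside ∷_) (smallSubsets U c)) * (N * N ^ u)
      ≡⟨ cong (_* (N * N ^ u)) (trans (length-++ (map (outside ∷_) (smallSubsets U (suc c))))
           (cong₂ _+_ (length-map (outside ∷_) (smallSubsets U (suc c))) (length-map (inside ∷_) (smallSubsets U c)))) ⟩
    (ℓ₁ + ℓ₂) * (N * N ^ u)
      ≡⟨ solve 4 (λ a b c d → (a :+ b) :* (c :* d) := c :* (a :* d) :+ c :* (b :* d)) refl ℓ₁ ℓ₂ N (N ^ u) ⟩
    N * (ℓ₁ * N ^ u) + N * (ℓ₂ * N ^ u)
      ≤⟨ +-mono-≤ (*-monoʳ-≤ N (length-smallSubsets N U (suc c)))
                  (*-monoʳ-≤ N (length-smallSubsets N U c)) ⟩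
    -- Pascal's rule has split the count by membership of the first element; the sum closes up
    -- because N · N^(c+1) + N · N^c = N^(c+1) (N + 1).
    N * (N * N ^ c * suc N ^ u) + N * (N ^ c * suc N ^ u)
      ≡⟨ solve 3 (λ a b c → a :* (a :* b :* c) :+ a :* (b :* c) := a :* b :* ((con 1 :+ a) :* c)) refl N (N ^ c) (suc N ^ u) ⟩
    N * N ^ c * (suc N * suc N ^ u) ∎
    where
    open ≤-Reasoning
    open +-*-Solver
    u  = ∣ U ∣
    ℓ₁ = length (smallSubsets U (suc c))
    ℓ₂ = length (smallSubsets U c)

-- Tensors given by square-free polynomials of bounded degree.

module Polynomials where

  open SliceRank
  open Subsets

  open import Data.Fin.Base using (Fin; zero; suc)
  import Data.Fin.Properties as Fin
  open import Data.Fin.Subset using (Subset; ∣_∣; _⊆_; _∪_; ⊥; ⁅_⁆) renaming (_∈_ to _∈ₛ_)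
  open import Data.Fin.Subset.Properties
  open import Data.Integer.Base using (ℤ; 0ℤ; 1ℤ; _+_; _*_; _-_)
  open import Data.Integer.Properties hiding (_≤?_)
  open import Data.Integer.Solver using (module +-*-Solver)
  open import Data.List.Base using (List; _++_; map; length)
  open import Data.List.Membership.Propositional using (_∈_)
  open import Data.List.Membership.Propositional.Properties using (∈-map⁺; ∈-++⁺ˡ; ∈-++⁺ʳ)
  open import Data.List.Properties using (length-map; length-++)
  import Data.Nat.Base as ℕ
  import Data.Nat.Properties as ℕ
  import Data.Nat.Solver as ℕSolver
  open import Data.Product.Base using (_×_; _,_)
  open import Data.Empty using (⊥-elim)
  open import Data.Vec.Functional using (foldr)
  open import Algebra.Properties.CommutativeMonoid.Sum +-0-commutativeMonoid using (sum)
  open import Function.Base using (_∘_)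
  open import Relation.Binary.PropositionalEquality
  open import Relation.Nullary using (Dec; yes; no; contradiction)

  -- The Iverson bracket.
  ⟦_⟧ : ∀ {P : Set} → Dec P → ℤ
  ⟦ yes _ ⟧ = 1ℤ
  ⟦ no  _ ⟧ = 0ℤ

  ⟦⟧-cong : ∀ {P Q : Set} (P? : Dec P) (Q? : Dec Q) → (P → Q) → (Q → P) → ⟦ P? ⟧ ≡ ⟦ Q? ⟧
  ⟦⟧-cong (yes p) (yes q) _ _ = refl
  ⟦⟧-cong (yes p) (no ¬q) f _ = contradiction (f p) ¬q
  ⟦⟧-cong (no ¬p) (yes q) _ g = contradiction (g q) ¬p
  ⟦⟧-cong (no ¬p) (no ¬q) _ _ = refl

  ∏ : ∀ {n} → (Fin n → ℤ) → ℤ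
  ∏ = foldr _*_ 1ℤ

  sum-singleton : ∀ {n} (f : Fin n → ℤ) w → (∀ v → v ≢ w → f v ≡ 0ℤ) → sum f ≡ f w
  sum-singleton {ℕ.suc n} f zero h =
    trans (cong (f zero +_) (sum-0 (f ∘ suc) λ v → h (suc v) λ ())) (+-identityʳ (f zero))
    where
    sum-0 : ∀ {n} (g : Fin n → ℤ) → (∀ v → g v ≡ 0ℤ) → sum g ≡ 0ℤ
    sum-0 {ℕ.zero}  g h = refl
    sum-0 {ℕ.suc n} g h = cong₂ _+_ (h zero) (sum-0 (g ∘ suc) (h ∘ suc))
  sum-singleton {ℕ.suc n} f (suc w) h = trans
    (cong₂ _+_ (h zero λ ()) (sum-singleton (f ∘ suc) w λ v v≢w → h (suc v) (v≢w ∘ Fin.suc-injective)))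
    (+-identityˡ (f (suc w)))

  -- Lets one statement about a variable serve all three arguments of a tensor.
  coord : ∀ {X : Set} → Axis → X → X → X → X
  coord X-axis x y z = x
  coord Y-axis x y z = y
  coord Z-axis x y z = z

  module _ {n} {X : Set} (set : X → Subset n) (U : Subset n) where

    -- The square-free monomial ∏_{v ∈ S} x_v, evaluated at indicator vectors.
    monomial : Subset n → X → ℤ
    monomial S x = ⟦ S ⊆? set x ⟧

    -- Indicator variables are idempotent, so products of square-free monomials stay square-free.
    monomial-∪ : ∀ R S x → monomial (R ∪ S) x ≡ monomial R x * monomial S x
    monomial-∪ R S x with R ⊆? set x | S ⊆? set x | (R ∪ S) ⊆? set x
    ... | yes r | yes s | yes _ = refl
    ... | yes r | yes s | no ¬p = ⊥-elim (¬p (∪-least r s))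
    ... | yes r | no ¬s | yes p = ⊥-elim (¬s (p ∘ q⊆p∪q R S))
    ... | yes r | no ¬s | no  _ = refl
    ... | no ¬r | _     | yes p = ⊥-elim (¬r (p ∘ p⊆p∪q S))
    ... | no ¬r | _     | no  _ = refl

    monomial-⊥ : ∀ x → monomial ⊥ x ≡ 1ℤ
    monomial-⊥ x with ⊥ ⊆? set x
    ... | yes _ = refl
    ... | no ¬p = ⊥-elim (¬p ⊥⊆)

    -- `R`, `S` and `Q` hold the variables taken from the first, second and third argument. As the
    -- monomials are square-free, degrees are cardinalities.
    record Exponent (d : ℕ.ℕ) : Set where
      constructor exponent
      field
        {R S Q} : Subset n
        R⊆U     : R ⊆ U
        S⊆U     : S ⊆ U
        Q⊆U     : Q ⊆ U
        degree  : ∣ R ∣ ℕ.+ ∣ S ∣ ℕ.+ ∣ Q ∣ ℕ.≤ d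

    evaluate : ∀ {d} → Exponent d → Tensor X
    evaluate (exponent {R} {S} {Q} _ _ _ _) x y z = monomial R x * monomial S y * monomial Q z

    -- Repeated variables merge in the unions, which can only lower the degree.
    multiply : ∀ {d e} → Exponent d → Exponent e → Exponent (d ℕ.+ e)
    multiply (exponent {R} {S} {Q} r s q deg) (exponent {R′} {S′} {Q′} r′ s′ q′ deg′) =
      exponent {R = R ∪ R′} {S ∪ S′} {Q ∪ Q′}
               (∪-least r r′) (∪-least s s′) (∪-least q q′)
        (ℕ.≤-trans (ℕ.+-mono-≤ (ℕ.+-mono-≤ (∣p∪q∣≤∣p∣+∣q∣ R R′) (∣p∪q∣≤∣p∣+∣q∣ S S′)) (∣p∪q∣≤∣p∣+∣q∣ Q Q′))
          (ℕ.≤-trans (ℕ.≤-reflexive (interchange (∣ R ∣) (∣ R′ ∣) (∣ S ∣) (∣ S′ ∣) (∣ Q ∣) (∣ Q′ ∣))) (ℕ.+-mono-≤ deg deg′)))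
      where
      interchange : ∀ a a′ b b′ c c′ → (a ℕ.+ a′) ℕ.+ (b ℕ.+ b′) ℕ.+ (c ℕ.+ c′) ≡
                                       (a ℕ.+ b ℕ.+ c) ℕ.+ (a′ ℕ.+ b′ ℕ.+ c′)
      interchange = solve 6 (λ a a′ b b′ c c′ →
        (a :+ a′) :+ (b :+ b′) :+ (c :+ c′) := (a :+ b :+ c) :+ (a′ :+ b′ :+ c′)) refl
        where open ℕSolver.+-*-Solver

    evaluate-multiply : ∀ {d e} (m : Exponent d) (m′ : Exponent e) →
      evaluate (multiply m m′) ≗₃ λ x y z → evaluate m x y z * evaluate m′ x y z
    evaluate-multiply (exponent {R} {S} {Q} _ _ _ _) (exponent {R′} {S′} {Q′} _ _ _ _) x y z
      rewrite monomial-∪ R R′ x | monomial-∪ S S′ y | monomial-∪ Q Q′ z =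
      solve 6 (λ a a′ b b′ c c′ →
        (a :* a′) :* (b :* b′) :* (c :* c′) := (a :* b :* c) :* (a′ :* b′ :* c′)) refl
        (monomial R x) (monomial R′ x) (monomial S y) (monomial S′ y) (monomial Q z) (monomial Q′ z)
      where open +-*-Solver

    -- Certifies that a tensor agrees pointwise with an integer combination of monomials of total
    -- degree at most `d` in the variables of `U`.
    data Poly (d : ℕ.ℕ) : Tensor X → Set where
      zero : ∀ {T} → T ≗₃ (λ _ _ _ → 0ℤ) → Poly d T
      plus : ∀ {R S T} → T ≗₃ (λ x y z → R x y z + S x y z) → Poly d R → Poly d S → Poly d T
      term : ∀ {T} a (m : Exponent d) → T ≗₃ (λ x y z → a * evaluate m x y z) → Poly d T

    poly-resp : ∀ {d S T} → T ≗₃ S → Poly d S → Poly d T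
    poly-resp eq (zero eq′)     = zero λ x y z → trans (eq x y z) (eq′ x y z)
    poly-resp eq (plus eq′ p q) = plus (λ x y z → trans (eq x y z) (eq′ x y z)) p q
    poly-resp eq (term a m eq′) = term a m λ x y z → trans (eq x y z) (eq′ x y z)

    poly-+ : ∀ {d S T} → Poly d S → Poly d T → Poly d (λ x y z → S x y z + T x y z)
    poly-+ = plus λ _ _ _ → refl

    private
      term-* : ∀ {d e T} a (m : Exponent d) → Poly e T → Poly (d ℕ.+ e) (λ x y z → a * evaluate m x y z * T x y z)
      term-* a m (zero eq) =
        zero λ x y z → trans (cong (a * evaluate m x y z *_) (eq x y z)) (*-zeroʳ (a * evaluate m x y z))
      term-* a m (plus eq p q) =
        plus (λ x y z → trans (cong (a * evaluate m x y z *_) (eq x y z)) (*-distribˡ-+ (a * evaluate m x y z) _ _))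
             (term-* a m p) (term-* a m q)
      term-* a m (term b m′ eq) = term (a * b) (multiply m m′) λ x y z →
        trans (cong (a * evaluate m x y z *_) (eq x y z))
          (trans (regroup a (evaluate m x y z) b (evaluate m′ x y z))
            (cong (a * b *_) (sym (evaluate-multiply m m′ x y z))))
        where
        regroup : ∀ a m b m′ → a * m * (b * m′) ≡ a * b * (m * m′)
        regroup = solve 4 (λ a m b m′ → a :* m :* (b :* m′) := a :* b :* (m :* m′)) refl
          where open +-*-Solver

    poly-* : ∀ {d e S T} → Poly d S → Poly e T → Poly (d ℕ.+ e) (λ x y z → S x y z * T x y z)
    poly-* {T = T} (zero eq) _ =
      zero λ x y z → trans (cong (_* T x y z) (eq x y z)) (*-zeroˡ (T x y z))
    poly-* {T = T} (plus {R} {S} eq p p′) q =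
      plus (λ x y z → trans (cong (_* T x y z) (eq x y z)) (*-distribʳ-+ (T x y z) (R x y z) (S x y z))) (poly-* p q) (poly-* p′ q)
    poly-* {T = T} (term a m eq) q =
      poly-resp (λ x y z → cong (_* T x y z) (eq x y z)) (term-* a m q)

    -- The monomial is the empty one. The bound `d` is left free, so that constants can be added to
    -- polynomials of any degree.
    poly-const : ∀ {d} a → Poly d (λ _ _ _ → a)
    poly-const a = term a (exponent {R = ⊥} {⊥} {⊥} (⊥⊆ {p = U}) (⊥⊆ {p = U}) (⊥⊆ {p = U}) deg) λ x y z → sym (trans
      (cong (a *_) (cong₂ _*_ (cong₂ _*_ (monomial-⊥ x) (monomial-⊥ y)) (monomial-⊥ z)))
      (*-identityʳ a))
      where
      deg : ∀ {d} → ∣ ⊥ {n} ∣ ℕ.+ ∣ ⊥ {n} ∣ ℕ.+ ∣ ⊥ {n} ∣ ℕ.≤ d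
      deg rewrite ∣⊥∣≡0 n = ℕ.z≤n

    poly-var : ∀ d {v} → v ∈ₛ U → Poly 1 (λ x y z → monomial ⁅ v ⁆ (coord d x y z))
    poly-var d {v} v∈U = var d
      where
      ⁅v⁆⊆U : ⁅ v ⁆ ⊆ U
      ⁅v⁆⊆U w∈⁅v⁆ rewrite x∈⁅y⁆⇒x≡y v w∈⁅v⁆ = v∈U
      var : ∀ d → Poly 1 (λ x y z → monomial ⁅ v ⁆ (coord d x y z))
      var X-axis = term 1ℤ (exponent {R = ⁅ v ⁆} {⊥} {⊥} ⁅v⁆⊆U (⊥⊆ {p = U}) (⊥⊆ {p = U}) deg) λ x y z → sym (trans
        (cong (1ℤ *_) (cong₂ (λ a b → monomial ⁅ v ⁆ x * a * b) (monomial-⊥ y) (monomial-⊥ z)))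
        (solve 1 (λ a → con 1ℤ :* (a :* con 1ℤ :* con 1ℤ) := a) refl (monomial ⁅ v ⁆ x)))
        where
        open +-*-Solver
        deg : ∣ ⁅ v ⁆ ∣ ℕ.+ ∣ ⊥ {n} ∣ ℕ.+ ∣ ⊥ {n} ∣ ℕ.≤ 1
        deg rewrite ∣⊥∣≡0 n | ∣⁅x⁆∣≡1 v = ℕ.≤-refl
      var Y-axis = term 1ℤ (exponent {R = ⊥} {⁅ v ⁆} {⊥} (⊥⊆ {p = U}) ⁅v⁆⊆U (⊥⊆ {p = U}) deg) λ x y z → sym (trans
        (cong (1ℤ *_) (cong₂ (λ a b → a * monomial ⁅ v ⁆ y * b) (monomial-⊥ x) (monomial-⊥ z)))
        (solve 1 (λ a → con 1ℤ :* (con 1ℤ :* a :* con 1ℤ) := a) refl (monomial ⁅ v ⁆ y)))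
        where
        open +-*-Solver
        deg : ∣ ⊥ {n} ∣ ℕ.+ ∣ ⁅ v ⁆ ∣ ℕ.+ ∣ ⊥ {n} ∣ ℕ.≤ 1
        deg rewrite ∣⊥∣≡0 n | ∣⁅x⁆∣≡1 v = ℕ.≤-refl
      var Z-axis = term 1ℤ (exponent {R = ⊥} {⊥} {⁅ v ⁆} (⊥⊆ {p = U}) (⊥⊆ {p = U}) ⁅v⁆⊆U deg) λ x y z → sym (trans
        (cong (1ℤ *_) (cong₂ (λ a b → a * b * monomial ⁅ v ⁆ z) (monomial-⊥ x) (monomial-⊥ y)))
        (solve 1 (λ a → con 1ℤ :* (con 1ℤ :* con 1ℤ :* a) := a) refl (monomial ⁅ v ⁆ z)))
        where
        open +-*-Solver
        deg : ∣ ⊥ {n} ∣ ℕ.+ ∣ ⊥ {n} ∣ ℕ.+ ∣ ⁅ v ⁆ ∣ ℕ.≤ 1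
        deg rewrite ∣⊥∣≡0 n | ∣⁅x⁆∣≡1 v = ℕ.≤-refl

    -- Allows sums over the whole ground set although only elements of `U` are variables: a
    -- polynomial is required only where the condition holds.
    poly-guard : ∀ {d T} {P : Set} (P? : Dec P) → (P → Poly d T) → Poly d (λ x y z → ⟦ P? ⟧ * T x y z)
    poly-guard {T = T} (yes p) f = poly-resp (λ x y z → *-identityˡ (T x y z)) (f p)
    poly-guard {T = T} (no ¬p) f = zero λ x y z → *-zeroˡ (T x y z)

    poly-sum : ∀ {d m} {T : Fin m → Tensor X} → (∀ v → Poly d (T v)) → Poly d (λ x y z → sum λ v → T v x y z)
    poly-sum {m = ℕ.zero}  p = zero λ _ _ _ → refl
    poly-sum {m = ℕ.suc m} p = poly-+ (p zero) (poly-sum (p ∘ suc))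

    poly-∏ : ∀ {d m} {T : Fin m → Tensor X} → (∀ i → Poly d (T i)) → Poly (m ℕ.* d) (λ x y z → ∏ λ i → T i x y z)
    poly-∏ {m = ℕ.zero}  p = poly-const 1ℤ
    poly-∏ {m = ℕ.suc m} p = poly-* (p zero) (poly-∏ (p ∘ suc))

    onAxis : ℕ.ℕ → Axis → List (Axis × (X → ℤ))
    onAxis c d = map (λ S → d , monomial S) (smallSubsets U c)

    lowDegree : ℕ.ℕ → List (Axis × (X → ℤ))
    lowDegree c = onAxis c X-axis ++ onAxis c Y-axis ++ onAxis c Z-axis

    length-lowDegree : ∀ c → length (lowDegree c) ≡ 3 ℕ.* length (smallSubsets U c)
    length-lowDegree c = trans
      (length-++ (onAxis c X-axis)) (cong₂ ℕ._+_ (length-map _ L)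
        (trans (length-++ (onAxis c Y-axis)) (cong₂ ℕ._+_ (length-map _ L)
          (trans (length-map _ L) (sym (ℕ.+-identityʳ (length L)))))))
      where L = smallSubsets U c

    -- Pigeonhole: three degrees above c would add up to at least 3 (c + 1), so each monomial has
    -- degree at most c in one argument. Its part in that argument becomes the one-variable
    -- function, the rest and the coefficient the cofactor.
    poly-span : ∀ {d c T} → d ℕ.< 3 ℕ.* ℕ.suc c → Poly d T → Span (lowDegree c) T
    poly-span d<3c (zero eq)     = zero eq
    poly-span d<3c (plus eq p q) = plus eq (poly-span d<3c p) (poly-span d<3c q)
    poly-span {d} {c} d<3c (term a (exponent {R} {S} {Q} r s q deg) eq)
      with ∣ R ∣ ℕ.≤? c | ∣ S ∣ ℕ.≤? c | ∣ Q ∣ ℕ.≤? c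
    ... | yes R≤c | _ | _ = single {d = X-axis} {monomial R} (λ y z → a * (monomial S y * monomial Q z))
      (∈-++⁺ˡ (∈-map⁺ _ (∈-smallSubsets U c r R≤c)))
      λ x y z → trans (eq x y z) (regroup (monomial R x) (monomial S y) (monomial Q z))
      where
      regroup : ∀ u v w → a * (u * v * w) ≡ u * (a * (v * w))
      regroup = solve 4 (λ a u v w → a :* (u :* v :* w) := u :* (a :* (v :* w))) refl a
        where open +-*-Solver
    ... | no _ | yes S≤c | _ = single {d = Y-axis} {monomial S} (λ x z → a * (monomial R x * monomial Q z))
      (∈-++⁺ʳ (onAxis c X-axis) (∈-++⁺ˡ (∈-map⁺ _ (∈-smallSubsets U c s S≤c))))
      λ x y z → trans (eq x y z) (regroup (monomial R x) (monomial S y) (monomial Q z))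
      where
      regroup : ∀ u v w → a * (u * v * w) ≡ v * (a * (u * w))
      regroup = solve 4 (λ a u v w → a :* (u :* v :* w) := v :* (a :* (u :* w))) refl a
        where open +-*-Solver
    ... | no _ | no _ | yes Q≤c = single {d = Z-axis} {monomial Q} (λ x y → a * (monomial R x * monomial S y))
      (∈-++⁺ʳ (onAxis c X-axis) (∈-++⁺ʳ (onAxis c Y-axis) (∈-map⁺ _ (∈-smallSubsets U c q Q≤c))))
      λ x y z → trans (eq x y z) (regroup (monomial R x) (monomial S y) (monomial Q z))
      where
      regroup : ∀ u v w → a * (u * v * w) ≡ w * (a * (u * v))
      regroup = solve 4 (λ a u v w → a :* (u :* v :* w) := w :* (a :* (u :* v))) refl a
        where open +-*-Solver
    ... | no R≰c | no S≰c | no Q≰c = contradiction d<3c (ℕ.≤⇒≯ (ℕ.≤-trans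
      (ℕ.≤-trans (ℕ.≤-reflexive (three (ℕ.suc c)))
        (ℕ.+-mono-≤ (ℕ.+-mono-≤ (ℕ.≰⇒> R≰c) (ℕ.≰⇒> S≰c)) (ℕ.≰⇒> Q≰c))) deg))
      where
      three : ∀ c → 3 ℕ.* c ≡ c ℕ.+ c ℕ.+ c
      three = solve 1 (λ c → con 3 :* c := c :+ c :+ c) refl
        where open ℕSolver.+-*-Solver

-- Averaging over colourings to obtain rainbow sets.

module Colourings where

  open import Data.Bool.Base using (Bool; true; false; _∧_)
  open import Data.Fin.Base using (Fin; zero; suc)
  open import Data.Fin.Properties using (any?; _≟_)
  open import Data.Fin.Subset using (Subset; inside; outside; ∣_∣; _∈_; ⊤)
  open import Data.Fin.Subset.Properties using (∣⊤∣≡n)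
  open import Data.List.Base using (List; []; _∷_; length; filterᵇ)
  open import Data.List.Relation.Unary.All using (All; []; _∷_)
  open import Data.Nat.Base
  open import Data.Nat.Properties hiding (_≟_)
  open import Algebra.Properties.Semiring.Sum +-*-semiring using (sum; sum-cong-≗; ∑-distrib-+; *-distribʳ-sum)
  open import Data.Nat.Solver using (module +-*-Solver)
  open import Data.Product.Base using (∃; _×_; _,_; proj₁; proj₂)
  open import Data.Vec.Base using (Vec; []; _∷_; lookup; here; there; _[_]≔_)
  open import Data.Vec.Properties using (lookup∘update; lookup∘update′; lookup-replicate)
  open import Function.Base using (_∘_)
  open import Relation.Binary.PropositionalEquality
  open import Relation.Nullary using (yes; no; contradiction)

  -- `A` has exactly one element of each colour, expressed by an inverse `sel` of the colouring on
  -- `A`.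
  record Transversal {n k} (col : Fin n → Fin k) (A : Subset n) : Set where
    field
      sel     : Fin k → Fin n
      sel-∈   : ∀ i → sel i ∈ A
      col-sel : ∀ i → col (sel i) ≡ i
      sel-col : ∀ {v} → v ∈ A → sel (col v) ≡ v

  𝟙 : Bool → ℕ
  𝟙 true  = 1
  𝟙 false = 0

  ∣E∣≡1+∣E-c∣ : ∀ {k} (E : Subset k) c → lookup E c ≡ inside → ∣ E ∣ ≡ suc ∣ E [ c ]≔ outside ∣
  ∣E∣≡1+∣E-c∣ (inside  ∷ E) zero    _  = refl
  ∣E∣≡1+∣E-c∣ (inside  ∷ E) (suc c) eq = cong suc (∣E∣≡1+∣E-c∣ E c eq)
  ∣E∣≡1+∣E-c∣ (outside ∷ E) (suc c) eq = ∣E∣≡1+∣E-c∣ E c eq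

  sum-indicator : ∀ {k} (E : Subset k) → sum (𝟙 ∘ lookup E) ≡ ∣ E ∣
  sum-indicator []            = refl
  sum-indicator (inside  ∷ E) = cong suc (sum-indicator E)
  sum-indicator (outside ∷ E) = sum-indicator E

  sum-const : ∀ k a → sum {k} (λ _ → a) ≡ k * a
  sum-const zero    a = refl
  sum-const (suc k) a = cong (a +_) (sum-const k a)

  sum-< : ∀ {k t} (f : Fin k → ℕ) → (∀ c → f c < t) → k + sum f ≤ k * t
  sum-< {zero}  f f<t = z≤n
  sum-< {suc k} {t} f f<t = begin
    suc k + (f zero + sum (f ∘ suc))     ≡⟨ solve 3 (λ k a b → con 1 :+ k :+ (a :+ b) := con 1 :+ a :+ (k :+ b)) refl k (f zero) _ ⟩
    suc (f zero) + (k + sum (f ∘ suc))   ≤⟨ +-mono-≤ (f<t zero) (sum-< (f ∘ suc) (f<t ∘ suc)) ⟩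
    t + k * t                            ∎
    where
    open ≤-Reasoning
    open +-*-Solver

  -- Otherwise all k values are at most t - 1 and their sum is at most k t - k, which is less than k
  -- t as k is positive.
  sum-average : ∀ k .{{_ : NonZero k}} t (f : Fin k → ℕ) → k * t ≤ sum f → ∃ λ c → t ≤ f c
  sum-average k@(suc j) t f kt≤ with any? (λ c → t ≤? f c)
  ... | yes found = found
  ... | no  none  = contradiction (≤-trans (sum-< f λ c → ≰⇒> λ t≤fc → none (c , t≤fc)) kt≤)
                                  (<⇒≱ (s≤s (m≤n+m (sum f) j)))

  module _ {k : ℕ} where

    -- S is coloured injectively by colours from E.
    rainbow : ∀ {m} → Vec (Fin k) m → Subset m → Subset k → Bool
    rainbow []       []            E = true
    rainbow (c ∷ cs) (outside ∷ S) E = rainbow cs S E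
    rainbow (c ∷ cs) (inside  ∷ S) E = lookup E c ∧ rainbow cs S (E [ c ]≔ outside)

    -- Plays the part of the expectation over a uniformly random colouring, scaled by the number
    -- `k ^ m` of colourings.
    total : ∀ m → (Vec (Fin k) m → ℕ) → ℕ
    total zero    f = f []
    total (suc m) f = sum λ c → total m (f ∘ (c ∷_))

    total-cong : ∀ m {f g} → (∀ cs → f cs ≡ g cs) → total m f ≡ total m g
    total-cong zero    f≗g = f≗g []
    total-cong (suc m) f≗g = sum-cong-≗ λ c → total-cong m (f≗g ∘ (c ∷_))

    total-+ : ∀ m f g → total m (λ cs → f cs + g cs) ≡ total m f + total m g
    total-+ zero    f g = refl
    total-+ (suc m) f g = trans (sum-cong-≗ λ c → total-+ m (f ∘ (c ∷_)) (g ∘ (c ∷_)))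
      (∑-distrib-+ (λ c → total m (f ∘ (c ∷_))) (λ c → total m (g ∘ (c ∷_))))

    total-*ʳ : ∀ m f a → total m (λ cs → f cs * a) ≡ total m f * a
    total-*ʳ zero    f a = refl
    total-*ʳ (suc m) f a = trans (sum-cong-≗ λ c → total-*ʳ m (f ∘ (c ∷_)) a)
      (sym (*-distribʳ-sum a (λ c → total m (f ∘ (c ∷_)))))

    total-0 : ∀ m → total m (λ _ → 0) ≡ 0
    total-0 m = trans (total-*ʳ m (λ _ → 0) 0) (*-zeroʳ (total m (λ _ → 0)))

    -- Colours are fixed one position at a time, each chosen so that the average over the remaining
    -- positions stays at least `t`.
    total-average : .{{_ : NonZero k}} → ∀ m f t → k ^ m * t ≤ total m f → ∃ λ cs → t ≤ f cs
    total-average zero    f t t≤ = [] , subst (_≤ f []) (*-identityˡ t) t≤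
    total-average (suc m) f t t≤
      with c , t≤c ← sum-average k (k ^ m * t) _ (≤-trans (≤-reflexive (sym (*-assoc k (k ^ m) t))) t≤)
      with cs , t≤f ← total-average m (f ∘ (c ∷_)) t t≤c = c ∷ cs , t≤f

    -- A point outside `S` has k possible colours; the points of `S` have s, s - 1, ..., 1 choices
    -- among the colours still in `E`. The count s! k^(m-s) is multiplied by k^s to avoid
    -- subtraction.
    total-rainbow : ∀ s m (S : Subset m) (E : Subset k) → ∣ S ∣ ≡ s → ∣ E ∣ ≡ s →
                    total m (λ cs → 𝟙 (rainbow cs S E)) * k ^ s ≡ s ! * k ^ m
    total-rainbow .0 zero [] E refl _ = refl
    total-rainbow s (suc m) (outside ∷ S) E ∣S∣ ∣E∣ = begin
      sum {k} (λ _ → T) * k ^ s   ≡⟨ cong (_* k ^ s) (sum-const k T) ⟩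
      k * T * k ^ s           ≡⟨ *-assoc k T (k ^ s) ⟩
      k * (T * k ^ s)         ≡⟨ cong (k *_) (total-rainbow s m S E ∣S∣ ∣E∣) ⟩
      k * (s ! * k ^ m)       ≡⟨ solve 3 (λ a b c → a :* (b :* c) := b :* (a :* c)) refl k (s !) (k ^ m) ⟩
      s ! * (k * k ^ m)       ∎
      where
      open ≡-Reasoning
      open +-*-Solver
      T = total m (λ cs → 𝟙 (rainbow cs S E))
    total-rainbow (suc s) (suc m) (inside ∷ S) E ∣S∣ ∣E∣ = begin
      sum g * (k * k ^ s)
        ≡⟨ solve 3 (λ a b c → a :* (b :* c) := b :* (a :* c)) refl (sum g) k (k ^ s) ⟩
      k * (sum g * k ^ s)
        ≡⟨ cong (k *_) (*-distribʳ-sum (k ^ s) g) ⟩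
      k * sum (λ c → g c * k ^ s)
        ≡⟨ cong (k *_) (sum-cong-≗ per-colour) ⟩
      k * sum (λ c → 𝟙 (lookup E c) * (s ! * k ^ m))
        ≡⟨ cong (k *_) (*-distribʳ-sum (s ! * k ^ m) (𝟙 ∘ lookup E)) ⟨
      k * (sum (𝟙 ∘ lookup E) * (s ! * k ^ m))
        ≡⟨ cong (λ a → k * (a * (s ! * k ^ m))) (trans (sum-indicator E) ∣E∣) ⟩
      k * (suc s * (s ! * k ^ m))
        ≡⟨ solve 4 (λ a b c d → a :* (b :* (c :* d)) := b :* c :* (a :* d)) refl k (suc s) (s !) (k ^ m) ⟩
      suc s * s ! * (k * k ^ m) ∎
      where
      open ≡-Reasoning
      open +-*-Solver
      g : Fin k → ℕ
      g c = total m (λ cs → 𝟙 (lookup E c ∧ rainbow cs S (E [ c ]≔ outside)))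
      per-colour : ∀ c → g c * k ^ s ≡ 𝟙 (lookup E c) * (s ! * k ^ m)
      per-colour c with lookup E c in eq
      ... | false = cong (_* k ^ s) (total-0 m)
      ... | true  = trans (total-rainbow s m S (E [ c ]≔ outside) (suc-injective ∣S∣)
                             (suc-injective (trans (sym (∣E∣≡1+∣E-c∣ E c eq)) ∣E∣)))
                          (sym (+-identityʳ _))

    rainbows : ∀ {n} → Vec (Fin k) n → List (Subset n) → List (Subset n)
    rainbows cs = filterᵇ λ A → rainbow cs A ⊤

    -- Linearity of expectation: each member is rainbow in a proportion k!/k^k of all colourings.
    total-rainbows : ∀ {n} (F : List (Subset n)) → All (λ A → ∣ A ∣ ≡ k) F →
                     total n (λ cs → length (rainbows cs F)) * k ^ k ≡ length F * k ! * k ^ n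
    total-rainbows {n} []      []         = cong (_* k ^ k) (total-0 n)
    total-rainbows {n} (A ∷ F) (∣A∣ ∷ ∣F∣) = begin
      total n (λ cs → length (rainbows cs (A ∷ F))) * k ^ k
        ≡⟨ cong (_* k ^ k) (trans (total-cong n split) (total-+ n _ _)) ⟩
      (total n (λ cs → 𝟙 (rainbow cs A ⊤)) + T) * k ^ k
        ≡⟨ *-distribʳ-+ (k ^ k) (total n (λ cs → 𝟙 (rainbow cs A ⊤))) T ⟩
      total n (λ cs → 𝟙 (rainbow cs A ⊤)) * k ^ k + T * k ^ k
        ≡⟨ cong₂ _+_ (total-rainbow k n A ⊤ ∣A∣ (∣⊤∣≡n k)) (total-rainbows F ∣F∣) ⟩
      k ! * k ^ n + length F * k ! * k ^ n
        ≡⟨ *-distribʳ-+ (k ^ n) (k !) (length F * k !) ⟨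
      suc (length F) * k ! * k ^ n ∎
      where
      open ≡-Reasoning
      T = total n (λ cs → length (rainbows cs F))
      split : ∀ cs → length (rainbows cs (A ∷ F)) ≡ 𝟙 (rainbow cs A ⊤) + length (rainbows cs F)
      split cs with rainbow cs A ⊤
      ... | true  = refl
      ... | false = refl

    many-rainbows : .{{_ : NonZero k}} → ∀ {n} (F : List (Subset n)) → All (λ A → ∣ A ∣ ≡ k) F →
                    ∃ λ cs → length F * k ! ≤ length (rainbows cs F) * k ^ k
    many-rainbows {n} F ∣F∣ = total-average n (λ cs → length (rainbows cs F) * k ^ k) (length F * k !)
      (≤-reflexive (trans (*-comm (k ^ n) (length F * k !))
        (sym (trans (total-*ʳ n (λ cs → length (rainbows cs F)) (k ^ k)) (total-rainbows F ∣F∣)))))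

    private
      record Bijective {m} (cs : Vec (Fin k) m) (S : Subset m) (E : Subset k) : Set where
        field
          onto      : ∀ i → lookup E i ≡ inside → ∃ λ v → v ∈ S × lookup cs v ≡ i
          into      : ∀ {v} → v ∈ S → lookup E (lookup cs v) ≡ inside
          injective : ∀ {v w} → v ∈ S → w ∈ S → lookup cs v ≡ lookup cs w → v ≡ w

      open Bijective

      -- The recursion of `rainbow` removes each used colour from `E`, so no later element repeats
      -- it. Equal cardinalities make the colouring onto: when `S` is exhausted, so is `E`.
      rainbow⇒bijective : ∀ {m} cs (S : Subset m) E → ∣ S ∣ ≡ ∣ E ∣ → rainbow cs S E ≡ true → Bijective cs S E
      rainbow⇒bijective [] [] E 0≡∣E∣ _ .onto i i∈E = contradiction (trans 0≡∣E∣ (∣E∣≡1+∣E-c∣ E i i∈E)) λ ()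
      rainbow⇒bijective [] [] E _ _ .into ()
      rainbow⇒bijective [] [] E _ _ .injective ()
      rainbow⇒bijective (c ∷ cs) (outside ∷ S) E ∣S∣ r = record
        { onto      = λ i i∈E → let v , v∈S , eq = onto IH i i∈E in suc v , there v∈S , eq
        ; into      = λ { (there v∈S) → into IH v∈S }
        ; injective = λ { (there v∈S) (there w∈S) eq → cong suc (injective IH v∈S w∈S eq) }
        }
        where IH = rainbow⇒bijective cs S E ∣S∣ r
      rainbow⇒bijective (c ∷ cs) (inside ∷ S) E ∣S∣ r with lookup E c in c∈E
      ... | true = record { onto = onto′ ; into = into′ ; injective = injective′ }
        where
        IH = rainbow⇒bijective cs S (E [ c ]≔ outside) (suc-injective (trans ∣S∣ (∣E∣≡1+∣E-c∣ E c c∈E))) r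
        c-fresh : ∀ {v} → v ∈ S → lookup cs v ≢ c
        c-fresh v∈S refl = contradiction (trans (sym (into IH v∈S)) (lookup∘update _ E outside)) λ ()
        onto′ : ∀ i → lookup E i ≡ inside → ∃ λ v → v ∈ inside ∷ S × lookup (c ∷ cs) v ≡ i
        onto′ i i∈E with i ≟ c
        ... | yes i≡c = zero , here , sym i≡c
        ... | no  i≢c with v , v∈S , eq ← onto IH i (trans (lookup∘update′ i≢c E outside) i∈E) =
          suc v , there v∈S , eq
        into′ : ∀ {v} → v ∈ inside ∷ S → lookup E (lookup (c ∷ cs) v) ≡ inside
        into′ here        = c∈E
        into′ (there v∈S) = trans (sym (lookup∘update′ (c-fresh v∈S) E outside)) (into IH v∈S)
        injective′ : ∀ {v w} → v ∈ inside ∷ S → w ∈ inside ∷ S → lookup (c ∷ cs) v ≡ lookup (c ∷ cs) w → v ≡ w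
        injective′ here        here        eq = refl
        injective′ here        (there w∈S) eq = contradiction (sym eq) (c-fresh w∈S)
        injective′ (there v∈S) here        eq = contradiction eq (c-fresh v∈S)
        injective′ (there v∈S) (there w∈S) eq = cong suc (injective IH v∈S w∈S eq)

    rainbow⇒transversal : ∀ {n} (cs : Vec (Fin k) n) A → ∣ A ∣ ≡ k → rainbow cs A ⊤ ≡ true →
                          Transversal (lookup cs) A
    rainbow⇒transversal cs A ∣A∣ r = record
      { sel     = λ i → proj₁ (choose i)
      ; sel-∈   = λ i → proj₁ (proj₂ (choose i))
      ; col-sel = λ i → proj₂ (proj₂ (choose i))
      ; sel-col = λ {v} v∈A → let w , w∈A , eq = choose (lookup cs v) in injective bij w∈A v∈A eq
      }
      where
      bij = rainbow⇒bijective cs A ⊤ (trans ∣A∣ (sym (∣⊤∣≡n k))) r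
      choose : ∀ i → ∃ λ v → v ∈ A × lookup cs v ≡ i
      choose i = onto bij i (lookup-replicate i inside)

-- The tensor that detects sunflowers, and its polynomial form.

module SunflowerTensor where

  open SliceRank
  open Polynomials
  open Colourings using (Transversal)
  open Transversal

  open import Data.Empty using (⊥; ⊥-elim)
  open import Data.Fin.Base using (Fin; zero; suc)
  open import Data.Fin.Properties using (_≟_; any?)
  open import Data.Fin.Subset using (Subset; ⁅_⁆; _⊆_; _∩_; _∈_; _∉_)
  open import Data.Fin.Subset.Properties
  open import Data.Integer.Base using (ℤ; 0ℤ; 1ℤ; -1ℤ; _+_; _*_; _-_)
  import Data.Integer.Properties as ℤ
  open import Algebra.Properties.CommutativeMonoid.Sum ℤ.+-0-commutativeMonoid using (sum)
  import Data.Nat.Base as ℕ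
  open import Data.Product.Base using (_×_; _,_; proj₁; proj₂)
  open import Data.Sum.Base using (_⊎_; inj₁; inj₂)
  open import Defs using (IsSunflower)
  open import Function.Base using (_∘_)
  open import Relation.Binary.PropositionalEquality
  open import Relation.Nullary using (¬_; Dec; yes; no; contradiction)
  open import Relation.Nullary.Decidable using (_×-dec_)

  ⟦⟧-yes : ∀ {P : Set} (P? : Dec P) → P → ⟦ P? ⟧ ≡ 1ℤ
  ⟦⟧-yes (yes _) _ = refl
  ⟦⟧-yes (no ¬p) p = contradiction p ¬p

  ⟦⟧-no : ∀ {P : Set} (P? : Dec P) → ¬ P → ⟦ P? ⟧ ≡ 0ℤ
  ⟦⟧-no (yes p) ¬p = contradiction p ¬p
  ⟦⟧-no (no _)  _  = refl

  ∏-0 : ∀ {m} (f : Fin m → ℤ) i → f i ≡ 0ℤ → ∏ f ≡ 0ℤ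
  ∏-0 f zero    eq = trans (cong (_* ∏ (f ∘ suc)) eq) (ℤ.*-zeroˡ (∏ (f ∘ suc)))
  ∏-0 f (suc i) eq = trans (cong (f zero *_) (∏-0 (f ∘ suc) i eq)) (ℤ.*-zeroʳ (f zero))

  ∏-≢0 : ∀ {m} (f : Fin m → ℤ) → (∀ i → f i ≢ 0ℤ) → ∏ f ≢ 0ℤ
  ∏-≢0 {ℕ.suc m} f f≢0 eq with ℤ.i*j≡0⇒i≡0∨j≡0 (f zero) eq
  ... | inj₁ f₀≡0 = f≢0 zero f₀≡0
  ... | inj₂ rest = ∏-≢0 (f ∘ suc) (f≢0 ∘ suc) rest

  -- The value is 2 on three equal arguments, -1 on three distinct ones, and 0 when exactly two
  -- agree.
  equalOrDistinct : ∀ {n} → Fin n → Fin n → Fin n → ℤ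
  equalOrDistinct a b c = ⟦ a ≟ b ⟧ + ⟦ b ≟ c ⟧ + ⟦ a ≟ c ⟧ - 1ℤ

  equalOrDistinct-≢0 : ∀ {n} (a b c : Fin n) → equalOrDistinct a b c ≢ 0ℤ →
                       (a ≡ b × b ≡ c) ⊎ (a ≢ b × b ≢ c × a ≢ c)
  equalOrDistinct-≢0 a b c ne with a ≟ b | b ≟ c | a ≟ c
  ... | yes p | yes q | _     = inj₁ (p , q)
  ... | yes p | no ¬q | yes r = contradiction (trans (sym p) r) ¬q
  ... | yes p | no ¬q | no ¬r = contradiction refl ne
  ... | no ¬p | yes q | yes r = contradiction (trans r (sym q)) ¬p
  ... | no ¬p | yes q | no ¬r = contradiction refl ne
  ... | no ¬p | no ¬q | yes r = contradiction refl ne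
  ... | no ¬p | no ¬q | no ¬r = inj₂ (¬p , ¬q , ¬r)

  equalOrDistinct-diagonal : ∀ {n} (a : Fin n) → equalOrDistinct a a a ≢ 0ℤ
  equalOrDistinct-diagonal a eq rewrite ⟦⟧-yes (a ≟ a) refl = contradiction eq λ ()

  transversal-⊆ : ∀ {n k} {col : Fin n → Fin k} {A B} (a : Transversal col A) (b : Transversal col B) →
                  (∀ i → sel a i ≡ sel b i) → A ⊆ B
  transversal-⊆ {col = col} {B = B} a b eq {v} v∈A =
    subst (_∈ B) (trans (sym (eq (col v))) (sel-col a v∈A)) (sel-∈ b (col v))

  module _ {n k} {col : Fin n → Fin k} {A B C : Subset n}
           (a : Transversal col A) (b : Transversal col B) (c : Transversal col C)
           where

    private
      common : Set
      common = ∀ i → (sel a i ≡ sel b i × sel b i ≡ sel c i) ⊎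
                     (sel a i ≢ sel b i × sel b i ≢ sel c i × sel a i ≢ sel c i)

      module _ (h : common) where

        shared-ab : ∀ {v} → v ∈ A → v ∈ B → v ∈ C
        shared-ab {v} v∈A v∈B with h (col v)
        ... | inj₁ (_ , eq)    = subst (_∈ C) (trans (sym eq) (sel-col b v∈B)) (sel-∈ c (col v))
        ... | inj₂ (ne , _)    = contradiction (trans (sel-col a v∈A) (sym (sel-col b v∈B))) ne

        shared-bc : ∀ {v} → v ∈ B → v ∈ C → v ∈ A
        shared-bc {v} v∈B v∈C with h (col v)
        ... | inj₁ (eq , _)     = subst (_∈ A) (trans eq (sel-col b v∈B)) (sel-∈ a (col v))
        ... | inj₂ (_ , ne , _) = contradiction (trans (sel-col b v∈B) (sym (sel-col c v∈C))) ne

        shared-ac : ∀ {v} → v ∈ A → v ∈ C → v ∈ B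
        shared-ac {v} v∈A v∈C with h (col v)
        ... | inj₁ (eq , _)     = subst (_∈ B) (trans (sym eq) (sel-col a v∈A)) (sel-∈ b (col v))
        ... | inj₂ (_ , _ , ne) = contradiction (trans (sel-col a v∈A) (sym (sel-col c v∈C))) ne

    -- An element of two of the sets is the selected element of its colour in both. This rules out
    -- the distinct case for that colour, so the third set contains it too.
    sunflower : common → IsSunflower A B C
    sunflower h = ⊆-antisym ab (to-ab ∘ project) , ⊆-antisym ac (to-ac ∘ project) , ⊆-antisym bc (to-bc ∘ project)
      where
      project : ∀ {v} → v ∈ A ∩ B ∩ C → v ∈ A × v ∈ B × v ∈ C
      project v∈K = let v∈A , v∈BC = x∈p∩q⁻ A (B ∩ C) v∈K in v∈A , x∈p∩q⁻ B C v∈BC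
      to-ab : ∀ {v} → v ∈ A × v ∈ B × v ∈ C → v ∈ A ∩ B
      to-ab (p , q , _) = x∈p∩q⁺ (p , q)
      to-ac : ∀ {v} → v ∈ A × v ∈ B × v ∈ C → v ∈ A ∩ C
      to-ac (p , _ , r) = x∈p∩q⁺ (p , r)
      to-bc : ∀ {v} → v ∈ A × v ∈ B × v ∈ C → v ∈ B ∩ C
      to-bc (_ , q , r) = x∈p∩q⁺ (q , r)
      ab : A ∩ B ⊆ A ∩ B ∩ C
      ab v∈ = let p , q = x∈p∩q⁻ A B v∈ in x∈p∩q⁺ (p , x∈p∩q⁺ (q , shared-ab h p q))
      ac : A ∩ C ⊆ A ∩ B ∩ C
      ac v∈ = let p , r = x∈p∩q⁻ A C v∈ in x∈p∩q⁺ (p , x∈p∩q⁺ (shared-ac h p r , r))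
      bc : B ∩ C ⊆ A ∩ B ∩ C
      bc v∈ = let q , r = x∈p∩q⁻ B C v∈ in x∈p∩q⁺ (shared-bc h q r , x∈p∩q⁺ (q , r))

  module _ {n k} {col : Fin n → Fin k} {X : Set} (set : X → Subset n)
           (transversal : ∀ x → Transversal col (set x)) where

    private
      s : X → Fin k → Fin n
      s x = sel (transversal x)

    sunflowerTensor : Tensor X
    sunflowerTensor x y z = ∏ λ i → equalOrDistinct (s x i) (s y i) (s z i)

    sunflowerTensor-diagonal : ∀ x → sunflowerTensor x x x ≢ 0ℤ
    sunflowerTensor-diagonal x = ∏-≢0 _ λ i → equalOrDistinct-diagonal (s x i)

    -- If no factor vanishes, each colour shows three equal or three distinct elements. Were two of
    -- the sets equal, every colour would be of the first kind and all three indices would coincide;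
    -- so the sets are distinct and form a sunflower.
    sunflowerTensor-off-diagonal :
      (∀ {x y} → set x ≡ set y → x ≡ y) →
      (∀ x y z → set x ≢ set y → set x ≢ set z → set y ≢ set z → ¬ IsSunflower (set x) (set y) (set z)) →
      ∀ x y z → ¬ (x ≡ y × y ≡ z) → sunflowerTensor x y z ≡ 0ℤ
    sunflowerTensor-off-diagonal set-injective sunflower-free x y z ne
      with any? (λ i → equalOrDistinct (s x i) (s y i) (s z i) ℤ.≟ 0ℤ)
    ... | yes (i , eq) = ∏-0 _ i eq
    ... | no none = contradiction (sunflower (transversal x) (transversal y) (transversal z) h)
                      (sunflower-free x y z x≢y x≢z y≢z)
      where
      h : ∀ i → (s x i ≡ s y i × s y i ≡ s z i) ⊎ (s x i ≢ s y i × s y i ≢ s z i × s x i ≢ s z i)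
      h i = equalOrDistinct-≢0 (s x i) (s y i) (s z i) λ eq → none (i , eq)

      same : ∀ x y → (∀ i → s x i ≡ s y i) → x ≡ y
      same x y eq = set-injective (⊆-antisym
        (transversal-⊆ (transversal x) (transversal y) eq)
        (transversal-⊆ (transversal y) (transversal x) (sym ∘ eq)))

      all-equal : (∀ i → s x i ≡ s y i × s y i ≡ s z i) → ⊥
      all-equal eq = ne (same x y (proj₁ ∘ eq) , same y z (proj₂ ∘ eq))

      sel-≡ : ∀ {x y} → set x ≡ set y → ∀ i → s x i ≡ s y i
      sel-≡ eq i rewrite set-injective eq = refl

      x≢y : set x ≢ set y
      x≢y eq = all-equal λ i → case-xy i (h i)
        where
        case-xy : ∀ i → _ → s x i ≡ s y i × s y i ≡ s z i
        case-xy i (inj₁ both)     = both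
        case-xy i (inj₂ (ne , _)) = contradiction (sel-≡ eq i) ne

      y≢z : set y ≢ set z
      y≢z eq = all-equal λ i → case-yz i (h i)
        where
        case-yz : ∀ i → _ → s x i ≡ s y i × s y i ≡ s z i
        case-yz i (inj₁ both)         = both
        case-yz i (inj₂ (_ , ne , _)) = contradiction (sel-≡ eq i) ne

      x≢z : set x ≢ set z
      x≢z eq = all-equal λ i → case-xz i (h i)
        where
        case-xz : ∀ i → _ → s x i ≡ s y i × s y i ≡ s z i
        case-xz i (inj₁ both)         = both
        case-xz i (inj₂ (_ , _ , ne)) = contradiction (sel-≡ eq i) ne

    -- Each colour class loses one element p i, whose indicator is 1 minus the sum of the others.
    module _ (U : Subset n) (p : Fin k → Fin n)
             (p∉U : ∀ i → p i ∉ U) (outside-U : ∀ x i → s x i ∉ U → s x i ≡ p i) where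

      private
        φ : Fin n → X → ℤ
        φ v = monomial set U ⁅ v ⁆

        φ-∈ : ∀ {v x} → v ∈ set x → φ v x ≡ 1ℤ
        φ-∈ {v} {x} v∈ with ⁅ v ⁆ ⊆? set x
        ... | yes _  = refl
        ... | no ¬⊆  = ⊥-elim (¬⊆ λ w∈ → subst (_∈ set x) (sym (x∈⁅y⁆⇒x≡y v w∈)) v∈)

        φ-∉ : ∀ {v x} → v ∉ set x → φ v x ≡ 0ℤ
        φ-∉ {v} {x} v∉ with ⁅ v ⁆ ⊆? set x
        ... | yes ⊆ = contradiction (⊆ (x∈⁅x⁆ v)) v∉
        ... | no _  = refl

        inClass : ∀ i v → Dec (v ∈ U × col v ≡ i)
        inClass i v = (v ∈? U) ×-dec (col v ≟ i)

        -- `set x` contains a single element of colour i, so at most one summand survives; the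
        -- bracket records whether that element is in `U`.
        class-sum : ∀ x i (g : Fin n → ℤ) →
                    sum (λ v → ⟦ inClass i v ⟧ * (φ v x * g v)) ≡ ⟦ s x i ∈? U ⟧ * g (s x i)
        class-sum x i g = trans (sum-singleton _ (s x i) vanish)
          (cong₂ _*_ (⟦⟧-cong (inClass i (s x i)) (s x i ∈? U) proj₁ λ ∈U → ∈U , col-sel (transversal x) i)
            (trans (cong (_* g (s x i)) (φ-∈ (sel-∈ (transversal x) i))) (ℤ.*-identityˡ (g (s x i)))))
          where
          vanish : ∀ v → v ≢ s x i → ⟦ inClass i v ⟧ * (φ v x * g v) ≡ 0ℤ
          vanish v v≢ with inClass i v
          ... | no _ = ℤ.*-zeroˡ (φ v x * g v)
          ... | yes (_ , refl) = trans (ℤ.*-identityˡ (φ v x * g v)) (trans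
            (cong (_* g v) (φ-∉ {v} {x} λ v∈ → v≢ (sym (sel-col (transversal x) v∈)))) (ℤ.*-zeroˡ (g v)))

        φ-sel : ∀ x y i → φ (s x i) y ≡ ⟦ s x i ≟ s y i ⟧
        φ-sel x y i with s x i ≟ s y i
        ... | yes eq = φ-∈ (subst (_∈ set y) (sym eq) (sel-∈ (transversal y) i))
        ... | no  ne = φ-∉ λ ∈y → ne (trans (sym (sel-col (transversal y) ∈y))
                                     (cong (s y) (col-sel (transversal x) i)))

        -- The first sum detects agreement inside `U`. Each complement is 1 exactly when the
        -- selected element lies outside `U`, where it must be `p i`, so their product detects
        -- agreement at the removed element. The factors `1ℤ` bring the sums into the form of
        -- `class-sum`.
        equality-expansion : ∀ x y i → ⟦ s x i ≟ s y i ⟧ ≡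
          sum (λ v → ⟦ inClass i v ⟧ * (φ v x * φ v y)) +
          (1ℤ - sum (λ v → ⟦ inClass i v ⟧ * (φ v x * 1ℤ))) * (1ℤ - sum (λ v → ⟦ inClass i v ⟧ * (φ v y * 1ℤ)))
        equality-expansion x y i
          rewrite class-sum x i (λ v → φ v y) | class-sum x i (λ _ → 1ℤ) | class-sum y i (λ _ → 1ℤ) | φ-sel x y i
          with s x i ∈? U | s y i ∈? U | s x i ≟ s y i
        ... | yes _  | yes _  | yes _  = refl
        ... | yes _  | yes _  | no  _  = refl
        ... | yes x∈ | no  y∉ | yes eq = contradiction (subst (_∈ U) eq x∈) y∉
        ... | yes _  | no  _  | no  _  = refl
        ... | no  x∉ | yes y∈ | yes eq = contradiction (subst (_∈ U) (sym eq) y∈) x∉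
        ... | no  _  | yes _  | no  _  = refl
        ... | no  _  | no  _  | yes _  = refl
        ... | no  x∉ | no  y∉ | no  ne = contradiction (trans (outside-U x i x∉) (sym (outside-U y i y∉))) ne

        poly-class-sum : ∀ {d} i {T : Fin n → Tensor X} → (∀ v → v ∈ U → Poly set U d (T v)) →
                         Poly set U d (λ x y z → sum λ v → ⟦ inClass i v ⟧ * T v x y z)
        poly-class-sum i poly = poly-sum set U λ v → poly-guard set U (inClass i v) λ (v∈U , _) → poly v v∈U

        poly-complement : ∀ d i → Poly set U 1 (λ x y z →
          1ℤ - sum (λ v → ⟦ inClass i v ⟧ * (φ v (coord d x y z) * 1ℤ)))
        poly-complement d i = poly-+ set U (poly-const set U 1ℤ) (poly-resp set U
          (λ x y z → sym (ℤ.-1*i≡-i _))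
          (poly-* set U {0} {1} (poly-const set U -1ℤ)
            (poly-class-sum i λ v v∈U → poly-* set U {1} {0} (poly-var set U d v∈U) (poly-const set U 1ℤ))))

        poly-equality : ∀ d e i → Poly set U 2 (λ x y z → ⟦ s (coord d x y z) i ≟ s (coord e x y z) i ⟧)
        poly-equality d e i = poly-resp set U
          (λ x y z → equality-expansion (coord d x y z) (coord e x y z) i)
          (poly-+ set U (poly-class-sum i λ v v∈U → poly-* set U {1} {1} (poly-var set U d v∈U) (poly-var set U e v∈U))
                        (poly-* set U {1} {1} (poly-complement d i) (poly-complement e i)))

      poly-sunflowerTensor : Poly set U (k ℕ.* 2) sunflowerTensor
      poly-sunflowerTensor = poly-∏ set U λ i →
        poly-+ set U (poly-+ set U (poly-+ set U (poly-equality X-axis Y-axis i) (poly-equality Y-axis Z-axis i))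
                        (poly-equality X-axis Z-axis i))
               (poly-const set U -1ℤ)

-- The bound in natural numbers.

module IntegerBound where

  open Arithmetic
  open SliceRank
  open Subsets
  open Polynomials
  open Colourings
  open SunflowerTensor
  open Transversal

  open import Data.Bool.Base using (T)
  open import Data.Bool.Properties using (T-≡)
  open import Data.Fin.Base using (Fin; zero; suc)
  open import Data.Fin.Subset using (Subset; inside; outside; ∣_∣; _⊆_; _─_; ⋃; ⊤)
    renaming (_∈_ to _∈ₛ_; _∉_ to _∉ₛ_)
  open import Data.Fin.Subset.Properties
  open import Data.List.Base using (List; []; _∷_; length; lookup)
  open import Data.List.Membership.Propositional using (_∈_)
  open import Data.List.Membership.Propositional.Properties using (∈-filter⁻; ∈-lookup)
  open import Data.List.Relation.Unary.All using (All; []; _∷_)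
  import Data.List.Relation.Unary.All as All
  open import Data.List.Relation.Unary.AllPairs using (_∷_)
  open import Data.List.Relation.Unary.Any using (here; there)
  open import Data.List.Relation.Unary.Unique.Propositional using (Unique)
  open import Data.List.Relation.Unary.Unique.Propositional.Properties using (filter⁺)
  open import Data.Nat.Base
  open import Data.Nat.DivMod using (m≡m%n+[m/n]*n; m%n<n)
  open import Data.Nat.Properties
  open import Data.Nat.Solver using (module +-*-Solver)
  open import Data.Product.Base using (_×_; _,_; proj₁; proj₂)
  open import Data.Vec.Base using ([]; _∷_; here; there)
  import Data.Vec.Base as Vec
  open import Defs using (Uniform; SunflowerFree; ⌈_/_⌉)
  open import Function.Base using (_∘_)
  open import Function.Bundles using (Equivalence)
  open import Relation.Binary.PropositionalEquality
  open import Relation.Nullary using (yes; no; contradiction)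

  ∣p─q∣+∣q∣≡∣p∣ : ∀ {n} (p q : Subset n) → q ⊆ p → ∣ p ─ q ∣ + ∣ q ∣ ≡ ∣ p ∣
  ∣p─q∣+∣q∣≡∣p∣ []            []            _   = refl
  ∣p─q∣+∣q∣≡∣p∣ (outside ∷ p) (outside ∷ q) q⊆p = ∣p─q∣+∣q∣≡∣p∣ p q (drop-∷-⊆ q⊆p)
  ∣p─q∣+∣q∣≡∣p∣ (inside  ∷ p) (outside ∷ q) q⊆p = cong suc (∣p─q∣+∣q∣≡∣p∣ p q (drop-∷-⊆ q⊆p))
  ∣p─q∣+∣q∣≡∣p∣ (inside  ∷ p) (inside  ∷ q) q⊆p =
    trans (+-suc _ _) (cong suc (∣p─q∣+∣q∣≡∣p∣ p q (drop-∷-⊆ q⊆p)))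
  ∣p─q∣+∣q∣≡∣p∣ (outside ∷ p) (inside  ∷ q) q⊆p = contradiction (q⊆p here) λ ()

  x∈q⇒x∉p─q : ∀ {n} (p q : Subset n) {x} → x ∈ₛ q → x ∉ₛ p ─ q
  x∈q⇒x∉p─q (outside ∷ p) (inside ∷ q) here ()
  x∈q⇒x∉p─q (inside  ∷ p) (inside ∷ q) here ()
  x∈q⇒x∉p─q (_ ∷ p) (_ ∷ q) (there x∈q) (there x∈p─q) = x∈q⇒x∉p─q p q x∈q x∈p─q

  p⊆q∧∣q∣≤∣p∣⇒p≡q : ∀ {n} (p q : Subset n) → p ⊆ q → ∣ q ∣ ≤ ∣ p ∣ → p ≡ q
  p⊆q∧∣q∣≤∣p∣⇒p≡q []            []            _   _ = refl
  p⊆q∧∣q∣≤∣p∣⇒p≡q (outside ∷ p) (outside ∷ q) p⊆q h = cong (outside ∷_) (p⊆q∧∣q∣≤∣p∣⇒p≡q p q (drop-∷-⊆ p⊆q) h)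
  p⊆q∧∣q∣≤∣p∣⇒p≡q (inside  ∷ p) (inside  ∷ q) p⊆q h = cong (inside ∷_) (p⊆q∧∣q∣≤∣p∣⇒p≡q p q (drop-∷-⊆ p⊆q) (s≤s⁻¹ h))
  p⊆q∧∣q∣≤∣p∣⇒p≡q (inside  ∷ p) (outside ∷ q) p⊆q _ = contradiction (p⊆q here) λ ()
  p⊆q∧∣q∣≤∣p∣⇒p≡q (outside ∷ p) (inside  ∷ q) p⊆q h =
    contradiction (p⊆q⇒∣p∣≤∣q∣ (drop-∷-⊆ p⊆q)) (<⇒≱ h)

  ∈⇒⊆⋃ : ∀ {n A} {F : List (Subset n)} → A ∈ F → A ⊆ ⋃ F
  ∈⇒⊆⋃ {F = B ∷ F} (here refl) = p⊆p∪q (⋃ F)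
  ∈⇒⊆⋃ {F = B ∷ F} (there A∈F) = q⊆p∪q B (⋃ F) ∘ ∈⇒⊆⋃ A∈F

  lookup-injective : ∀ {A : Set} {xs : List A} → Unique xs → ∀ i j → lookup xs i ≡ lookup xs j → i ≡ j
  lookup-injective (_   ∷ _) zero    zero    _  = refl
  lookup-injective (x∉  ∷ _) zero    (suc j) eq = contradiction eq (All.lookup x∉ (∈-lookup j))
  lookup-injective (x∉  ∷ _) (suc i) zero    eq = contradiction (sym eq) (All.lookup x∉ (∈-lookup i))
  lookup-injective (_   ∷ u) (suc i) (suc j) eq = cong suc (lookup-injective u i j eq)

  m≤⌈m/n⌉*n : ∀ m n .{{_ : NonZero n}} → m ≤ ⌈ m / n ⌉ * n
  m≤⌈m/n⌉*n m n@(suc n-1) = +-cancelʳ-≤ n-1 m (⌈ m / n ⌉ * n) (begin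
    m + n-1                              ≡⟨ m≡m%n+[m/n]*n (m + n-1) n ⟩
    (m + n-1) % n + ⌈ m / n ⌉ * n        ≤⟨ +-monoˡ-≤ (⌈ m / n ⌉ * n) (s≤s⁻¹ (m%n<n (m + n-1) n)) ⟩
    n-1 + ⌈ m / n ⌉ * n                  ≡⟨ +-comm n-1 _ ⟩
    ⌈ m / n ⌉ * n + n-1                  ∎)
    where open ≤-Reasoning

  -- Rankin's estimate followed by (1 + 1/N)^N ≤ 3. If `U` has fewer than N k elements, the missing
  -- exponent is supplied by N ≤ N + 1.
  count-smallSubsets : ∀ {n} N .{{_ : NonZero N}} k c (U : Subset n) → ∣ U ∣ ≤ N * k →
                       length (smallSubsets U c) ≤ 3 ^ k * N ^ c
  count-smallSubsets N k c U u≤Nk = *-cancelʳ-≤ ℓ (3 ^ k * N ^ c) (N ^ (N * k)) {{m^n≢0 N (N * k)}} (begin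
    ℓ * N ^ (N * k)                     ≡⟨ cong (ℓ *_) (split N) ⟩
    ℓ * (N ^ u * N ^ d)                 ≡⟨ *-assoc ℓ (N ^ u) (N ^ d) ⟨
    ℓ * N ^ u * N ^ d                   ≤⟨ *-mono-≤ (length-smallSubsets N U c) (^-monoˡ-≤ d (n≤1+n N)) ⟩
    N ^ c * suc N ^ u * suc N ^ d       ≡⟨ *-assoc (N ^ c) (suc N ^ u) (suc N ^ d) ⟩
    N ^ c * (suc N ^ u * suc N ^ d)     ≡⟨ cong (N ^ c *_) (split (suc N)) ⟨
    N ^ c * suc N ^ (N * k)             ≡⟨ cong (N ^ c *_) (^-*-assoc (suc N) N k) ⟨
    N ^ c * (suc N ^ N) ^ k             ≤⟨ *-monoʳ-≤ (N ^ c) (^-monoˡ-≤ k ([1+n]^n≤3n^n N)) ⟩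
    N ^ c * (3 * N ^ N) ^ k             ≡⟨ cong (N ^ c *_) ([m*n]^o≡m^o*n^o 3 (N ^ N) k) ⟩
    N ^ c * (3 ^ k * (N ^ N) ^ k)       ≡⟨ cong (λ a → N ^ c * (3 ^ k * a)) (^-*-assoc N N k) ⟩
    N ^ c * (3 ^ k * N ^ (N * k))       ≡⟨ solve 3 (λ a b c → a :* (b :* c) := b :* a :* c) refl (N ^ c) (3 ^ k) _ ⟩
    3 ^ k * N ^ c * N ^ (N * k)         ∎)
    where
    open ≤-Reasoning
    open +-*-Solver
    u = ∣ U ∣
    d = N * k ∸ u
    ℓ = length (smallSubsets U c)
    split : ∀ a → a ^ (N * k) ≡ a ^ u * a ^ d
    split a = trans (cong (a ^_) (sym (m+[n∸m]≡n u≤Nk))) (^-distribˡ-+-* a u d)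

  module _ {n k} {col : Fin n → Fin k} (G : List (Subset n)) (W : Subset n)
           (G⊆W : ∀ {A} → A ∈ G → A ⊆ W) (∣G∣ : Uniform k G)
           (transversals : All (Transversal col) G)
           (unique : Unique G) (sunflower-free : SunflowerFree G) where

    -- The elements removed from the colour classes are those of the first member `B`, which meets
    -- each class once. Thus `W ─ B` has k elements fewer than `W`, and the slice rank is compared
    -- on both sides.
    transversal-bound : ∀ N .{{_ : NonZero N}} c → ∣ W ∣ ≤ suc N * k → k * 2 < 3 * suc c →
                        length G ≤ 3 * (3 ^ k * N ^ c)
    transversal-bound N c ∣W∣≤ deg = from-member G refl
      where
      open ≤-Reasoning

      tr : ∀ x → Transversal col (lookup G x)
      tr x = All.lookup transversals (∈-lookup x)

      diagonal : Diagonal (sunflowerTensor (lookup G) tr)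
      diagonal = record
        { on-diagonal  = sunflowerTensor-diagonal (lookup G) tr
        ; off-diagonal = sunflowerTensor-off-diagonal (lookup G) tr
            (λ {x} {y} → lookup-injective unique x y)
            λ x y z → sunflower-free (∈-lookup x) (∈-lookup y) (∈-lookup z)
        }

      from-member : ∀ H → H ≡ G → length G ≤ 3 * (3 ^ k * N ^ c)
      from-member []      refl = z≤n
      from-member (B ∷ H) refl = begin
        length G                        ≤⟨ slice-rank-diagonal (lowDegree set U c) diagonal
                                             (poly-span set U deg poly) ⟩
        length (lowDegree set U c)      ≡⟨ length-lowDegree set U c ⟩
        3 * length (smallSubsets U c)   ≤⟨ *-monoʳ-≤ 3 (count-smallSubsets N k c U ∣U∣≤) ⟩
        3 * (3 ^ k * N ^ c)             ∎
        where
        set = lookup G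
        U = W ─ B
        b = tr zero
        B⊆W = G⊆W (here refl)
        ∣U∣≤ : ∣ U ∣ ≤ N * k
        ∣U∣≤ = +-cancelʳ-≤ k ∣ U ∣ (N * k) (begin
          ∣ U ∣ + k      ≡⟨ cong (∣ U ∣ +_) (All.head ∣G∣) ⟨
          ∣ U ∣ + ∣ B ∣  ≡⟨ ∣p─q∣+∣q∣≡∣p∣ W B B⊆W ⟩
          ∣ W ∣          ≤⟨ ∣W∣≤ ⟩
          k + N * k      ≡⟨ +-comm k (N * k) ⟩
          N * k + k      ∎)
        -- Every selected element is in `W`; outside `U` it is therefore in `B`, where it is the
        -- only element of its colour.
        outside-U : ∀ x i → sel (tr x) i ∉ₛ U → sel (tr x) i ≡ sel b i
        outside-U x i ∉U with sel (tr x) i ∈? B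
        ... | yes ∈B = trans (sym (sel-col b ∈B)) (cong (sel b) (col-sel (tr x) i))
        ... | no  ∉B = contradiction (x∈p∧x∉q⇒x∈p─q (G⊆W (∈-lookup x) (sel-∈ (tr x) i)) ∉B) ∉U
        poly = poly-sunflowerTensor set tr U (sel b) (λ i → x∈q⇒x∉p─q W B (sel-∈ b i)) outside-U

  m∸1-nonZero : ∀ m → 2 ≤ m → NonZero (m ∸ 1)
  m∸1-nonZero (suc zero)    (s≤s ())
  m∸1-nonZero (suc (suc m)) _ = _

  -- With quotient at most 1 the union has at most k elements, so every member fills it and the
  -- first two members coincide.
  2≤⌈∣⋃∣/k⌉ : ∀ {n} k .{{_ : NonZero k}} (F : List (Subset n)) → Unique F → Uniform k F → 2 ≤ length F →
              2 ≤ ⌈ ∣ ⋃ F ∣ / k ⌉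
  2≤⌈∣⋃∣/k⌉ k F@(A ∷ B ∷ _) ((A≢B ∷ _) ∷ _) (∣A∣ ∷ ∣B∣ ∷ _) _ =
    ≰⇒> λ q≤1 → A≢B (trans (fills q≤1 ∣A∣ (here refl)) (sym (fills q≤1 ∣B∣ (there (here refl)))))
    where
    fills : ⌈ ∣ ⋃ F ∣ / k ⌉ ≤ 1 → ∀ {S} → ∣ S ∣ ≡ k → S ∈ F → S ≡ ⋃ F
    fills q≤1 {S} ∣S∣ S∈F = p⊆q∧∣q∣≤∣p∣⇒p≡q S (⋃ F) (∈⇒⊆⋃ S∈F) (begin
      ∣ ⋃ F ∣                  ≤⟨ m≤⌈m/n⌉*n ∣ ⋃ F ∣ k ⟩
      ⌈ ∣ ⋃ F ∣ / k ⌉ * k      ≤⟨ *-monoˡ-≤ k q≤1 ⟩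
      1 * k                    ≡⟨ trans (*-identityˡ k) (sym ∣S∣) ⟩
      ∣ S ∣                    ∎)
      where open ≤-Reasoning
  2≤⌈∣⋃∣/k⌉ k []       _ _ ()
  2≤⌈∣⋃∣/k⌉ k (_ ∷ []) _ _ (s≤s ())

  -- One factor 3^k pays for the passage to rainbow sets, through k^k ≤ 3^k k!; the other comes from
  -- counting monomials.
  sunflower-free-bound : ∀ {n} k .{{_ : NonZero k}} (F : List (Subset n)) →
    Unique F → Uniform k F → SunflowerFree F → 2 ≤ length F →
    length F ≤ 3 * (9 ^ k * (⌈ ∣ ⋃ F ∣ / k ⌉ ∸ 1) ^ ⌈ 2 * k / 3 ⌉)
  sunflower-free-bound {n} k F unique uniform sunflower-free 2≤∣F∣
    with cs , many ← many-rainbows F uniform = *-cancelʳ-≤ (length F) _ (k !) {{k !≢0}} (begin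
    length F * k !                          ≤⟨ many ⟩
    length G * k ^ k                        ≤⟨ *-mono-≤ G-bound (n^n≤3^n*n! k) ⟩
    3 * (3 ^ k * N ^ c) * (3 ^ k * k !)     ≡⟨ regroup (3 ^ k) (N ^ c) (k !) ⟩
    3 * (3 ^ k * 3 ^ k * N ^ c) * k !       ≡⟨ cong (λ a → 3 * (a * N ^ c) * k !) ([m*n]^o≡m^o*n^o 3 3 k) ⟨
    3 * (9 ^ k * N ^ c) * k !               ∎)
    where
    open ≤-Reasoning
    open +-*-Solver
    regroup : ∀ a b d → 3 * (a * b) * (a * d) ≡ 3 * (a * a * b) * d
    regroup = solve 3 (λ a b d → con 3 :* (a :* b) :* (a :* d) := con 3 :* (a :* a :* b) :* d) refl
    W = ⋃ F
    -- The quotient is at least 2, so the truncated subtraction is exact and `N` is nonzero.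
    N = ⌈ ∣ W ∣ / k ⌉ ∸ 1
    c = ⌈ 2 * k / 3 ⌉
    G = rainbows cs F
    2≤q = 2≤⌈∣⋃∣/k⌉ k F unique uniform 2≤∣F∣
    instance
      N≢0 : NonZero N
      N≢0 = m∸1-nonZero ⌈ ∣ W ∣ / k ⌉ 2≤q

    G⊆F : ∀ {A} → A ∈ G → A ∈ F × T (rainbow cs A ⊤)
    G⊆F = ∈-filter⁻ _

    deg : k * 2 < 3 * suc c
    -- 2k ≤ 3c < 3 (c + 1). The chain ends in `3 * suc c` unfolded, without its leading `suc`.
    deg = s≤s (begin
      k * 2            ≡⟨ *-comm k 2 ⟩
      2 * k            ≤⟨ m≤⌈m/n⌉*n (2 * k) 3 ⟩
      c * 3            ≡⟨ *-comm c 3 ⟩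
      3 * c            ≤⟨ m≤n+m (3 * c) 2 ⟩
      2 + 3 * c        ≡⟨ solve 1 (λ c → con 2 :+ con 3 :* c := c :+ (con 1 :+ c :+ (con 1 :+ c :+ con 0))) refl c ⟩
      c + (suc c + (suc c + 0)) ∎)

    ∣W∣≤ : ∣ W ∣ ≤ suc N * k
    ∣W∣≤ = subst (λ q → ∣ W ∣ ≤ q * k) (sym (m+[n∸m]≡n (<⇒≤ 2≤q))) (m≤⌈m/n⌉*n ∣ W ∣ k)

    G-bound : length G ≤ 3 * (3 ^ k * N ^ c)
    G-bound = transversal-bound {col = Vec.lookup cs} G W
      (λ A∈G → ∈⇒⊆⋃ (proj₁ (G⊆F A∈G)))
      (All.tabulate λ A∈G → All.lookup uniform (proj₁ (G⊆F A∈G)))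
      (All.tabulate λ {A} A∈G → rainbow⇒transversal cs A (All.lookup uniform (proj₁ (G⊆F A∈G)))
        (Equivalence.to T-≡ (proj₂ (G⊆F A∈G))))
      (filter⁺ _ unique)
      (λ p q r → sunflower-free (proj₁ (G⊆F p)) (proj₁ (G⊆F q)) (proj₁ (G⊆F r)))
      N c ∣W∣≤ deg

-- Transfer to the real numbers.

module RealBound where

  open import Data.Integer.Base using (+_)
  open import Data.Nat.Base as ℕ using (ℕ; zero; suc; z≤n; s≤s)
  import Data.Nat.Properties as ℕ
  open import Data.Product.Base using (_,_)
  open import Data.Rational.Base using (0ℚ; _/_; _+_; _*_; _≤_; _<_)
  open import Data.Rational.Properties using (≤-trans; ≤-refl; <⇒≤; _≤?_; +-monoʳ-≤; +-identityʳ; module ≤-Reasoning)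
  import Defs as ℝ
  open import Defs using (ℝ; seq; fromℕ; frac-≤; frac-*; frac-nonNeg; Nested; ∛2; ∛2-nested; ∛2-lower; e; e-nested; expSum)
  open import Relation.Binary.PropositionalEquality
  open import Relation.Nullary.Decidable using (from-yes)

  ℕ-mono : ∀ {a b} → a ℕ.≤ b → + a / 1 ≤ + b / 1
  ℕ-mono {a} {b} a≤b = frac-≤ a 1 b 1 (ℕ.*-monoˡ-≤ 1 a≤b)

  *-lower : ∀ a b {p q} → + a / 1 ≤ p → + b / 1 ≤ q → + (a ℕ.* b) / 1 ≤ p * q
  *-lower a b {p} {q} a≤p b≤q = subst (_≤ p * q) (frac-* a 1 b 1)
    (ℝ.*-mono-≤ (frac-nonNeg a 1) (≤-trans (frac-nonNeg b 1) b≤q) a≤p b≤q)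

  ^-lower : ∀ a (x : ℝ) n j → + a / 1 ≤ seq x n → + (a ℕ.^ j) / 1 ≤ seq (x ℝ.^ j) n
  ^-lower a x n zero    a≤x = ≤-refl
  ^-lower a x n (suc j) a≤x = *-lower a (a ℕ.^ j) a≤x (^-lower a x n j a≤x)

  -- ∛2-lower 2 = 5/4 and expSum 2 = 5/2.
  9≤∛2*3e : ∀ n → 2 ℕ.≤ n → + 9 / 1 ≤ seq (∛2 ℝ.* (fromℕ 3 ℝ.* e)) n
  9≤∛2*3e n 2≤n = begin
    + 9 / 1                               ≤⟨ from-yes (+ 9 / 1 ≤? ∛2-lower 2 * (+ 3 / 1 * expSum 2)) ⟩
    ∛2-lower 2 * (+ 3 / 1 * expSum 2)     ≤⟨ ℝ.*-mono-≤ (from-yes (0ℚ ≤? ∛2-lower 2))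
                                               (≤-trans (from-yes (0ℚ ≤? + 3 / 1 * expSum 2)) 3e) (Nested.l-mono ∛2-nested (ℕ.≤⇒≤′ 2≤n)) 3e ⟩
    ∛2-lower n * (+ 3 / 1 * expSum (suc n)) ∎
    where
    open ≤-Reasoning
    expSum-mono : expSum 2 ≤ expSum (suc n)
    -- The sequence of `e` is shifted: `expSum 2` stands at index 1, so 1 ≤ n is what has to be
    -- supplied.
    expSum-mono = Nested.l-mono e-nested (ℕ.≤⇒≤′ (ℕ.≤-trans (s≤s z≤n) 2≤n))
    3e : + 3 / 1 * expSum 2 ≤ + 3 / 1 * expSum (suc n)
    3e = ℝ.*-mono-≤ (from-yes (0ℚ ≤? + 3 / 1)) (≤-trans (from-yes (0ℚ ≤? expSum 2)) expSum-mono)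
           ≤-refl expSum-mono

  -- The inequality holds between rational approximations, and `ε` is then added on the right. The
  -- factor `a` enters through 1 ≤ a.
  fromℕ-≤ : ∀ {m a} k N c → m ℕ.≤ 3 ℕ.* (9 ℕ.^ k ℕ.* N ℕ.^ c) → 1 ℕ.≤ a →
    fromℕ m ℝ.≤ fromℕ 3 ℝ.* fromℕ a ℝ.* (∛2 ℝ.* (fromℕ 3 ℝ.* e)) ℝ.^ k ℝ.* fromℕ N ℝ.^ c
  -- From index 2 on, the approximations of the base of the k-th power are at least 9.
  fromℕ-≤ {m} {a} k N c m≤ 1≤a ε ε>0 = 2 , λ n 2≤n → ≤-trans (bound n 2≤n) (p≤p+q ε>0)
    where
    RHS = fromℕ 3 ℝ.* fromℕ a ℝ.* (∛2 ℝ.* (fromℕ 3 ℝ.* e)) ℝ.^ k ℝ.* fromℕ N ℝ.^ c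
    p≤p+q : ∀ {p q} → 0ℚ < q → p ≤ p + q
    p≤p+q {p} {q} 0<q = subst (_≤ p + q) (+-identityʳ p) (+-monoʳ-≤ p (<⇒≤ 0<q))
    m≤3a9ᵏNᶜ : m ℕ.≤ 3 ℕ.* a ℕ.* 9 ℕ.^ k ℕ.* N ℕ.^ c
    m≤3a9ᵏNᶜ = ℕ.≤-trans m≤ (ℕ.≤-trans (ℕ.≤-reflexive (sym (ℕ.*-assoc 3 (9 ℕ.^ k) (N ℕ.^ c))))
      (ℕ.*-monoˡ-≤ (N ℕ.^ c) (ℕ.*-monoˡ-≤ (9 ℕ.^ k) (ℕ.*-monoʳ-≤ 3 1≤a))))
    bound : ∀ n → 2 ℕ.≤ n → + m / 1 ≤ seq RHS n
    bound n 2≤n = ≤-trans (ℕ-mono m≤3a9ᵏNᶜ)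
      (*-lower (3 ℕ.* a ℕ.* 9 ℕ.^ k) (N ℕ.^ c)
        (*-lower (3 ℕ.* a) (9 ℕ.^ k) (*-lower 3 a ≤-refl ≤-refl)
          (^-lower 9 (∛2 ℝ.* (fromℕ 3 ℝ.* e)) n k (9≤∛2*3e n 2≤n)))
        (^-lower N (fromℕ N) n c ≤-refl))

open import Data.Nat.Properties using (m≤n+m)
open import Defs using (ℝ; Uniform; SunflowerFree; ⌈_/_⌉; fromℕ; e; ∛2; _≤_; _*_; _^_)
open import Data.Fin.Subset using (Subset; ⋃; ∣_∣)
open import Data.List.Base using (List; length)
open import Data.List.Relation.Unary.Unique.Propositional using (Unique)
open import Data.Nat.Base as ℕ using (ℕ; NonZero; _∸_)

-- For a family with a single member M = k, so the last factor is a positive power of 0 and the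
-- right side vanishes; hence the family is taken with at least two members.
theorem1p8 : ∀ (n k : ℕ) .{{_ : NonZero k}} (F : List (Subset n)) →
    Unique F → Uniform k F → SunflowerFree F → 2 ℕ.≤ length F →
    let M = ∣ ⋃ F ∣
        c = ⌈ 2 ℕ.* k / 3 ⌉
    in fromℕ (length F) ≤
         fromℕ 3 * fromℕ (c ℕ.+ 1) * (∛2 * (fromℕ 3 * e)) ^ k * fromℕ (⌈ M / k ⌉ ∸ 1) ^ c
theorem1p8 n k F unique uniform sunflower-free 2≤∣F∣ =
  RealBound.fromℕ-≤ k (⌈ ∣ ⋃ F ∣ / k ⌉ ∸ 1) c
    (IntegerBound.sunflower-free-bound k F unique uniform sunflower-free 2≤∣F∣) (m≤n+m 1 c)
  where c = ⌈ 2 ℕ.* k / 3 ⌉
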